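{- Let $\mathscr{V}=(S_1,\dots,S_8)$ be any admissibly ordered orthoplicial Platonic configuration, with inversive coordinate vectors $\boldsymbol{v}_k=\boldsymbol{v}(S_k)$ and antipodal vector $\boldsymbol{v}_\mu=\tfrac12(\boldsymbol{v}_1+\boldsymbol{v}_5)$. Then $$\boldsymbol{v}_\mu=\tfrac12(\boldsymbol{v}_1+\boldsymbol{v}_5)=\tfrac12(\boldsymbol{v}_2+\boldsymbol{v}_6)=\tfrac12(\boldsymbol{v}_3+\boldsymbol{v}_7)=\tfrac12(\boldsymbol{v}_4+\boldsymbol{v}_8).$$ Hence the $V$-matrix $\boldsymbol{V}=\boldsymbol{V}(\mathscr{V})$ and the $F$-matrix $\boldsymbol{F}=\boldsymbol{F}(\mathscr{V})$ satisfy $\boldsymbol{V}=\boldsymbol{D}\boldsymbol{F}$, where $$\boldsymbol{D}=\begin{pmatrix}1&0&0&0&0\\0&1&0&0&0\\0&0&1&0&0\\0&0&0&1&0\\-1&0&0&0&2\\0&-1&0&0&2\\0&0&-1&0&2\\0&0&0&-1&2\end{pmatrix}.$$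
   Context: Work in $\hat{\mathbb{R}}^3=\mathbb{R}^3\cup\{\infty\}$. A "sphere" $S$ means a Euclidean sphere, or a plane (with $\infty$ added), together with a choice of orienting region $B$, one of the two components of its complement. Its inversive coordinate vector $\boldsymbol{v}(S)=(a,b,\hat x,\hat y,\hat z)$ (a row vector) is: for a Euclidean sphere with center $\boldsymbol{c}$ and oriented radius $r$ ($r>0$ if $B$ is the ball, $r<0$ if $B$ is the exterior), $b=1/r$ (the bend), $a=b|\boldsymbol{c}|^2-1/b$, and $(\hat x,\hat y,\hat z)=b\,\boldsymbol{c}$; for a plane $\{\boldsymbol{n}\cdot\boldsymbol{x}=h\}$ with $\boldsymbol{n}$ the unit normal pointing into $B$, $\boldsymbol{v}(S)=(2h,0,n_x,n_y,n_z)$. Möbius transformations of $\hat{\mathbb{R}}^3$ (all conformal and anti-conformal transformations) act on oriented spheres by mapping $(S,B)$ to its image. The standard configuration $\mathscr{V}_0=(S_1,\dots,S_8)$ consists of the spheres with inversive coordinates $(2,0,0,0,1)$, $(2,0,0,0,-1)$, $(1,1,\sqrt2,0,0)$, $(1,1,0,\sqrt2,0)$, $(0,2,0,0,-1)$, $(0,2,0,0,1)$, $(1,1,-\sqrt2,0,0)$, $(1,1,0,-\sqrt2,0)$, in this order. An orthoplicial Platonic configuration is the image of $\mathscr{V}_0$ under a Möbius transformation. An ordering $S_1,\dots,S_8$ of its spheres is admissible if distinct $S_i,S_j$ are tangent when $i\not\equiv j\pmod 4$ and disjoint when $i\equiv j\pmod 4$. The $V$-matrix of an admissibly ordered configuration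 is the $8\times5$ matrix with rows $\boldsymbol{v}_1,\dots,\boldsymbol{v}_8$; the $F$-matrix is the $5\times5$ matrix with rows $\boldsymbol{v}_1,\boldsymbol{v}_2,\boldsymbol{v}_3,\boldsymbol{v}_4,\boldsymbol{v}_\mu$. -}

module Defs where

open import Level using (0ℓ)
open import Algebra.Bundles using (CommutativeRing)
import Algebra.Properties.Ring
import Algebra.Properties.Semiring.Sum
import Algebra.Solver.Ring.NaturalCoefficients.Default as NatSolver
open import Data.Empty using (⊥)
open import Data.Fin.Base using (Fin; toℕ)
open import Data.Fin.Patterns
open import Data.Fin.Permutation using (Permutation′; _⟨$⟩ʳ_)
open import Data.Fin.Properties using (all?)
open import Data.List.Base using (List; foldr)
open import Data.Maybe.Base using (Maybe; just; nothing)
open import Data.Maybe.Relation.Binary.Pointwise using (Pointwise)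
open import Data.Nat.Base using (ℕ)
open import Data.Nat.DivMod using (_%_)
open import Data.Product.Base using (Σ; ∃-syntax; _×_; _,_; proj₁; proj₂)
open import Data.Sum.Base using (_⊎_; inj₁; inj₂)
open import Data.Unit.Base using (⊤)
open import Data.Vec.Functional using (Vector; []; _∷_)
open import Function.Base using (_$_)
open import Relation.Binary.Core using (Rel)
open import Relation.Binary.PropositionalEquality.Core using (_≡_; _≢_)
import Relation.Binary.Construct.NonStrictToStrict as ToStrict
import Relation.Binary.Reasoning.Setoid as SetoidReasoning
open import Relation.Binary.Structures using (IsDecTotalOrder)
open import Relation.Nullary using (Dec; yes; no; ¬_; contradiction)
open import Relation.Unary using (Pred; Satisfiable; _≐_)

-- The real numbers, given axiomatically as a (Dedekind-)complete ordered
-- field.  The order is decidable, as it is classically.  The inverse is a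
-- total operation about which nothing is assumed at 0.

record CompleteOrderedField : Set₁ where
  field
    commutativeRing : CommutativeRing 0ℓ 0ℓ

  open CommutativeRing commutativeRing public

  infix  4 _≤_
  infix  8 _⁻¹

  field
    _≤_             : Rel Carrier 0ℓ
    isDecTotalOrder : IsDecTotalOrder _≈_ _≤_
    +-monoˡ-≤       : ∀ z {x y} → x ≤ y → x + z ≤ y + z
    *-nonneg        : ∀ {x y} → 0# ≤ x → 0# ≤ y → 0# ≤ x * y
    1≉0             : ¬ 1# ≈ 0#
    _⁻¹             : Carrier → Carrier
    ⁻¹-inverseʳ     : ∀ {x} → ¬ x ≈ 0# → x * x ⁻¹ ≈ 1#

  UpperBound : Pred Carrier 0ℓ → Pred Carrier 0ℓ
  UpperBound P u = ∀ x → P x → x ≤ u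

  field
    supremum : (P : Pred Carrier 0ℓ) → Satisfiable P → Satisfiable (UpperBound P) →
               ∃[ s ] UpperBound P s × (∀ u → UpperBound P u → s ≤ u)

  open IsDecTotalOrder isDecTotalOrder public
    using (_≟_; _≤?_)
    renaming ( refl to ≤-refl; trans to ≤-trans; antisym to ≤-antisym
             ; reflexive to ≤-reflexive; total to ≤-total
             ; ≤-respˡ-≈ to ≤-respˡ-≈; ≤-respʳ-≈ to ≤-respʳ-≈ )

  open ToStrict _≈_ _≤_ public using (_<_)
  open Algebra.Properties.Semiring.Sum semiring public using (sum)

  2# : Carrier
  2# = 1# + 1#

  ½ : Carrier
  ½ = 2# ⁻¹

module Arithmetic (ℝ : CompleteOrderedField) where
  open CompleteOrderedField ℝ
  open Algebra.Properties.Ring ring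
  open NatSolver commutativeSemiring
  open SetoidReasoning setoid

  inverse-unique : ∀ {x y} → x * y ≈ 1# → x ⁻¹ ≈ y
  inverse-unique {x} {y} xy≈1 = begin
    x ⁻¹            ≈⟨ *-identityʳ _ ⟨
    x ⁻¹ * 1#       ≈⟨ *-congˡ xy≈1 ⟨
    x ⁻¹ * (x * y)  ≈⟨ solve 3 (λ i x y → i :* (x :* y) := (x :* i) :* y) refl _ _ _ ⟩
    (x * x ⁻¹) * y  ≈⟨ *-congʳ (⁻¹-inverseʳ x≉0) ⟩
    1# * y          ≈⟨ *-identityˡ y ⟩
    y               ∎
    where
    x≉0 : ¬ x ≈ 0#
    x≉0 x≈0 = 1≉0 (trans (sym xy≈1) (trans (*-congʳ x≈0) (zeroˡ y)))

  +-nonneg : ∀ {x y} → 0# ≤ x → 0# ≤ y → 0# ≤ x + y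
  +-nonneg {x} {y} 0≤x 0≤y =
    ≤-trans 0≤y (≤-respˡ-≈ (+-identityˡ y) (+-monoˡ-≤ y 0≤x))

  ≤⇒0≤- : ∀ {x y} → x ≤ y → 0# ≤ y - x
  ≤⇒0≤- {x} x≤y = ≤-respˡ-≈ (-‿inverseʳ x) (+-monoˡ-≤ (- x) x≤y)

  ≤0⇒0≤- : ∀ {x} → x ≤ 0# → 0# ≤ - x
  ≤0⇒0≤- x≤0 = ≤-respʳ-≈ (+-identityˡ _) (≤⇒0≤- x≤0)

  x≤x+nonneg : ∀ {x y} → 0# ≤ y → x ≤ x + y
  x≤x+nonneg {x} {y} 0≤y =
    ≤-respˡ-≈ (+-identityˡ x) (≤-respʳ-≈ (+-comm y x) (+-monoˡ-≤ x 0≤y))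

  0≤1 : 0# ≤ 1#
  0≤1 with ≤-total 0# 1#
  ... | inj₁ p = p
  ... | inj₂ p = ≤-respʳ-≈ (trans (-1*x≈-x (- 1#)) (-‿involutive 1#))
                   (*-nonneg (≤0⇒0≤- p) (≤0⇒0≤- p))

  0≤2 : 0# ≤ 2#
  0≤2 = +-nonneg 0≤1 0≤1

  2≉0 : ¬ 2# ≈ 0#
  2≉0 p = 1≉0 (≤-antisym (≤-respʳ-≈ p (x≤x+nonneg 0≤1)) 0≤1)

  2*½≈1 : 2# * ½ ≈ 1#
  2*½≈1 = ⁻¹-inverseʳ 2≉0

  ½≉0 : ¬ ½ ≈ 0#
  ½≉0 p = 1≉0 (trans (sym 2*½≈1) (trans (*-congˡ p) (zeroʳ 2#)))

  0≤½ : 0# ≤ ½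
  0≤½ with ≤-total 0# ½
  ... | inj₁ p = p
  ... | inj₂ p = contradiction (≤-antisym 1≤0 0≤1) 1≉0
    where
    0≤-1 : 0# ≤ - 1#
    0≤-1 = ≤-respʳ-≈ (trans (sym (-‿distribʳ-* 2# ½)) (-‿cong 2*½≈1))
             (*-nonneg 0≤2 (≤0⇒0≤- p))
    1≤0 : 1# ≤ 0#
    1≤0 = ≤-respʳ-≈ (-‿inverseʳ 1#) (x≤x+nonneg 0≤-1)

  -- √2 is the greatest x ≤ 2 with x ≤ g x, for the map
  -- g x = x + (2 - x²)/4, which is monotone on (-∞, 2] (Knaster–Tarski).

  private
    q : Carrier
    q = ½ * ½

    0≤q : 0# ≤ q
    0≤q = *-nonneg 0≤½ 0≤½

    4q≈1 : (2# * 2#) * q ≈ 1#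
    4q≈1 = begin
      (2# * 2#) * (½ * ½)    ≈⟨ solve 2 (λ t h → (t :* t) :* (h :* h) := (t :* h) :* (t :* h)) refl _ _ ⟩
      (2# * ½) * (2# * ½)    ≈⟨ *-cong 2*½≈1 2*½≈1 ⟩
      1# * 1#                ≈⟨ *-identityˡ 1# ⟩
      1#                     ∎

    g : Carrier → Carrier
    g x = x + (2# - x * x) * q

    g-step : ∀ {x y} → g y ≈ g x + q * ((y - x) * ((2# - x) + (2# - y)))
    g-step {x} {y} = begin
      y + (2# - y * y) * q
        ≈⟨ solve 4 (λ y t m q → y :+ (t :+ m) :* q := con 0 :+ y :+ (t :+ m) :* q) refl _ _ _ _ ⟩
      0# + y + (2# - y * y) * q
        ≈⟨ +-congʳ (+-congˡ y≈) ⟩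
      0# + (x + d * ((2# * 2#) * q)) + (2# - y * y) * q
        ≈⟨ +-congʳ (+-congʳ (zeroˡ q)) ⟨
      0# * q + (x + d * ((2# * 2#) * q)) + (2# - y * y) * q
        ≈⟨ +-congʳ (+-congʳ (*-congʳ (-‿inverseʳ (x * x)))) ⟨
      (x * x - x * x) * q + (x + d * ((2# * 2#) * q)) + (2# - y * y) * q
        ≈⟨ +-congʳ (+-congˡ (+-congˡ (*-congˡ (*-congʳ (*-congˡ 2≈))))) ⟩
      (x * x - x * x) * q + (x + d * ((2# * (x + d + e)) * q)) + (2# - y * y) * q
        ≈⟨ solve 7 (λ x d e q t m n →
              (x :* x :+ m) :* q
                :+ (x :+ d :* ((con 2 :* (x :+ d :+ e)) :* q)) :+ (t :+ n) :* q
              := x :+ (t :+ m) :* q :+ (q :* (d :* ((d :+ e) :+ e)))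
                :+ ((x :+ d) :* (x :+ d) :+ n) :* q)
              refl x d e q 2# (- (x * x)) (- (y * y)) ⟩
      g x + q * (d * ((d + e) + e)) + ((x + d) * (x + d) - y * y) * q
        ≈⟨ +-cong (+-congˡ (*-congˡ (*-congˡ (+-congʳ d+e≈)))) (*-congʳ zero′) ⟩
      g x + q * (d * ((2# - x) + e)) + 0# * q
        ≈⟨ +-congˡ (zeroˡ q) ⟩
      g x + q * (d * ((2# - x) + e)) + 0#
        ≈⟨ +-identityʳ _ ⟩
      g x + q * (d * ((2# - x) + (2# - y))) ∎
      where
      d = y - x
      e = 2# - y
      cancel : ∀ a b → a + (b - a) ≈ b
      cancel a b = begin
        a + (b - a)    ≈⟨ solve 3 (λ a b n → a :+ (b :+ n) := b :+ (a :+ n)) refl _ _ _ ⟩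
        b + (a - a)    ≈⟨ +-congˡ (-‿inverseʳ a) ⟩
        b + 0#         ≈⟨ +-identityʳ b ⟩
        b              ∎
      x+d≈y : x + d ≈ y
      x+d≈y = cancel x y
      2≈ : 2# ≈ x + d + e
      2≈ = sym (trans (+-congʳ x+d≈y) (cancel y 2#))
      d+e≈ : d + e ≈ 2# - x
      d+e≈ = begin
        (y - x) + (2# - y)   ≈⟨ solve 4 (λ y m t n → (y :+ m) :+ (t :+ n) := (y :+ (t :+ n)) :+ m) refl _ _ _ _ ⟩
        (y + (2# - y)) - x   ≈⟨ +-congʳ (cancel y 2#) ⟩
        2# - x               ∎
      y≈ : y ≈ x + d * ((2# * 2#) * q)
      y≈ = sym (trans (+-congˡ (trans (*-congˡ 4q≈1) (*-identityʳ d))) x+d≈y)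
      zero′ : (x + d) * (x + d) - y * y ≈ 0#
      zero′ = trans (+-congʳ (*-cong x+d≈y x+d≈y)) (-‿inverseʳ (y * y))

    g-mono : ∀ {x y} → x ≤ y → y ≤ 2# → g x ≤ g y
    g-mono x≤y y≤2 = ≤-respʳ-≈ (sym g-step) $ x≤x+nonneg $ *-nonneg 0≤q $
      *-nonneg (≤⇒0≤- x≤y) (+-nonneg (≤⇒0≤- (≤-trans x≤y y≤2)) (≤⇒0≤- y≤2))

    P : Pred Carrier 0ℓ
    P x = x ≤ 2# × x ≤ g x

    0≤g0 : 0# ≤ g 0#
    0≤g0 = x≤x+nonneg (*-nonneg (≤⇒0≤- (≤-respˡ-≈ (sym (zeroˡ 0#)) 0≤2)) 0≤q)

    sup-P = supremum P (0# , 0≤2 , 0≤g0) (2# , λ _ → proj₁)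

  √2 : Carrier
  √2 = proj₁ sup-P

  0≤√2 : 0# ≤ √2
  0≤√2 = proj₁ (proj₂ sup-P) 0# (0≤2 , 0≤g0)

  √2*√2≈2 : √2 * √2 ≈ 2#
  √2*√2≈2 = begin
    s * s                     ≈⟨ +-identityˡ _ ⟨
    0# + s * s                ≈⟨ +-congʳ 2-s²≈0 ⟨
    (2# - s * s) + s * s      ≈⟨ +-assoc _ _ _ ⟩
    2# + (- (s * s) + s * s)  ≈⟨ +-congˡ (-‿inverseˡ _) ⟩
    2# + 0#                   ≈⟨ +-identityʳ 2# ⟩
    2#                        ∎
    where
    s = √2
    ub = proj₁ (proj₂ sup-P)
    least = proj₂ (proj₂ sup-P)

    s≤2 : s ≤ 2#
    s≤2 = least 2# (λ _ → proj₁)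

    s≤gs : s ≤ g s
    s≤gs = least (g s) λ x Px → ≤-trans (proj₂ Px) (g-mono (ub x Px) s≤2)

    g2≤2 : g 2# ≤ 2#
    g2≤2 = ≤-respʳ-≈ eq (x≤x+nonneg (*-nonneg 0≤2 0≤q))
      where
      eq : g 2# + 2# * q ≈ 2#
      eq = begin
        2# + (2# - 2# * 2#) * q + 2# * q
          ≈⟨ solve 3 (λ t m q → t :+ (t :+ m) :* q :+ con 2 :* q := t :+ (t :+ con 2 :+ m) :* q) refl 2# (- (2# * 2#)) q ⟩
        2# + (2# + 2# - 2# * 2#) * q
          ≈⟨ +-congˡ (*-congʳ (+-congʳ (solve 0 (con 2 :+ con 2 := con 2 :* con 2) refl))) ⟩
        2# + (2# * 2# - 2# * 2#) * q
          ≈⟨ +-congˡ (trans (*-congʳ (-‿inverseʳ _)) (zeroˡ q)) ⟩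
        2# + 0#
          ≈⟨ +-identityʳ 2# ⟩
        2# ∎

    gs≤2 : g s ≤ 2#
    gs≤2 = ≤-trans (g-mono s≤2 ≤-refl) g2≤2

    gs≈s : g s ≈ s
    gs≈s = ≤-antisym (ub (g s) (gs≤2 , g-mono s≤gs gs≤2)) s≤gs

    2-s²≈0 : 2# - s * s ≈ 0#
    2-s²≈0 = begin
      w                    ≈⟨ *-identityʳ w ⟨
      w * 1#               ≈⟨ *-congˡ 4q≈1 ⟨
      w * ((2# * 2#) * q)  ≈⟨ solve 3 (λ w f q → w :* (f :* q) := f :* (w :* q)) refl _ _ _ ⟩
      (2# * 2#) * (w * q)  ≈⟨ *-congˡ (+-cancelˡ s (w * q) 0# (trans gs≈s (sym (+-identityʳ s)))) ⟩
      (2# * 2#) * 0#       ≈⟨ zeroʳ _ ⟩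
      0#                   ∎
      where w = 2# - s * s

module Inversive (ℝ : CompleteOrderedField) where
  open CompleteOrderedField ℝ
  open Arithmetic ℝ

  infix  4 _≋_ _≟ᵛ_ _≈ᴹ_ _≈̂_
  infixl 6 _+ᵛ_ _-ᵛ_
  infixr 7 _*ᵛ_ _*ᴹ_
  infix  8 _·_

  _≋_ : ∀ {n} → Rel (Vector Carrier n) 0ℓ
  x ≋ y = ∀ i → x i ≈ y i

  _≟ᵛ_ : ∀ {n} (x y : Vector Carrier n) → Dec (x ≋ y)
  x ≟ᵛ y = all? λ i → x i ≟ y i

  _+ᵛ_ _-ᵛ_ : ∀ {n} → Vector Carrier n → Vector Carrier n → Vector Carrier n
  (x +ᵛ y) i = x i + y i
  (x -ᵛ y) i = x i - y i

  _*ᵛ_ : ∀ {n} → Carrier → Vector Carrier n → Vector Carrier n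
  (t *ᵛ x) i = t * x i

  _·_ : ∀ {n} → Vector Carrier n → Vector Carrier n → Carrier
  x · y = sum λ i → x i * y i

  ∣_∣² : ∀ {n} → Vector Carrier n → Carrier
  ∣ x ∣² = x · x

  Matrix : ℕ → ℕ → Set
  Matrix m n = Vector (Vector Carrier n) m

  _≈ᴹ_ : ∀ {m n} → Rel (Matrix m n) 0ℓ
  A ≈ᴹ B = ∀ i j → A i j ≈ B i j

  _*ᴹ_ : ∀ {l m n} → Matrix l m → Matrix m n → Matrix l n
  (A *ᴹ B) i k = sum λ j → A i j * B j k

  ℝ³ : Set
  ℝ³ = Vector Carrier 3

  ℝ̂³ : Set
  ℝ̂³ = Maybe ℝ³

  pattern ∞ = nothing

  _≈̂_ : Rel ℝ̂³ 0ℓ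
  _≈̂_ = Pointwise _≋_

  -- "sphere c r" has centre c and oriented radius r; its orienting region is
  -- the ball if r > 0 and the exterior if r < 0.  "plane n h" is n · x = h,
  -- with n pointing into the orienting region.

  data OrientedSphere : Set where
    sphere : (c : ℝ³) (r : Carrier) → ¬ r ≈ 0# → OrientedSphere
    plane  : (n : ℝ³) (h : Carrier) → ∣ n ∣² ≈ 1# → OrientedSphere

  surface : OrientedSphere → Pred ℝ̂³ 0ℓ
  surface (sphere c r _) (just x) = ∣ x -ᵛ c ∣² ≈ r * r
  surface (sphere c r _) ∞        = ⊥
  surface (plane n h _)  (just x) = n · x ≈ h
  surface (plane n h _)  ∞        = ⊤

  region : OrientedSphere → Pred ℝ̂³ 0ℓ
  region (sphere c r _) (just x) = (0# < r × ∣ x -ᵛ c ∣² < r * r)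
                                 ⊎ (r < 0# × r * r < ∣ x -ᵛ c ∣²)
  region (sphere c r _) ∞        = r < 0#
  region (plane n h _)  (just x) = h < n · x
  region (plane n h _)  ∞        = ⊥

  inversiveCoordinates : OrientedSphere → Vector Carrier 5
  inversiveCoordinates (sphere c r _) = (b * ∣ c ∣² - b ⁻¹) ∷ b ∷ b *ᵛ c
    where b = r ⁻¹
  inversiveCoordinates (plane n h _)  = 2# * h ∷ 0# ∷ n

  Tangent : Rel OrientedSphere 0ℓ
  Tangent S T = ∃[ p ] (surface S p × surface T p ×
                        (∀ q → surface S q → surface T q → q ≈̂ p))

  Disjoint : Rel OrientedSphere 0ℓ
  Disjoint S T = ∀ p → ¬ (surface S p × surface T p)

  -- The orientation plays no role here.

  inversion : OrientedSphere → ℝ̂³ → ℝ̂³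
  inversion (sphere c r _) (just x) with x ≟ᵛ c
  ... | yes _ = ∞
  ... | no  _ = just (c +ᵛ (r * r * ∣ x -ᵛ c ∣² ⁻¹) *ᵛ (x -ᵛ c))
  inversion (sphere c r _) ∞        = just c
  inversion (plane n h _)  (just x) = just (x -ᵛ (2# * (n · x - h)) *ᵛ n)
  inversion (plane n h _)  ∞        = ∞

  -- The conformal and anti-conformal transformations of ℝ̂³ are exactly the
  -- finite compositions of inversions.

  IsMöbius : (ℝ̂³ → ℝ̂³) → Set
  IsMöbius f = ∃[ Ss ] (∀ p → f p ≈̂ foldr inversion p Ss)

  Image : (ℝ̂³ → ℝ̂³) → Pred ℝ̂³ 0ℓ → Pred ℝ̂³ 0ℓ
  Image f P q = ∃[ p ] (P p × f p ≈̂ q)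

  _Maps_To_ : (ℝ̂³ → ℝ̂³) → OrientedSphere → OrientedSphere → Set
  f Maps S To T = Image f (surface S) ≐ surface T × Image f (region S) ≐ region T

  private
    ∣0,0,x∣² : ∀ {x} → x * x ≈ 1# → ∣ 0# ∷ 0# ∷ x ∷ [] ∣² ≈ 1#
    ∣0,0,x∣² {x} xx≈1 =
      trans (+-cong (zeroˡ 0#) (+-cong (zeroˡ 0#) (+-identityʳ (x * x))))
        (trans (+-identityˡ _) (trans (+-identityˡ _) xx≈1))

    -1*-1≈1 : - 1# * - 1# ≈ 1#
    -1*-1≈1 = trans (-1*x≈-x (- 1#)) (-‿involutive 1#)
      where open Algebra.Properties.Ring ring

  𝒱₀ : Vector OrientedSphere 8
  𝒱₀ = plane  (0# ∷ 0# ∷ 1# ∷ [])   1# (∣0,0,x∣² (*-identityˡ 1#))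
     ∷ plane  (0# ∷ 0# ∷ - 1# ∷ []) 1# (∣0,0,x∣² -1*-1≈1)
     ∷ sphere (√2 ∷ 0# ∷ 0# ∷ [])   1# 1≉0
     ∷ sphere (0# ∷ √2 ∷ 0# ∷ [])   1# 1≉0
     ∷ sphere (0# ∷ 0# ∷ - ½ ∷ [])  ½  ½≉0
     ∷ sphere (0# ∷ 0# ∷ ½ ∷ [])    ½  ½≉0
     ∷ sphere (- √2 ∷ 0# ∷ 0# ∷ []) 1# 1≉0
     ∷ sphere (0# ∷ - √2 ∷ 0# ∷ []) 1# 1≉0
     ∷ []

  𝒱₀-inversiveCoordinates : Matrix 8 5
  𝒱₀-inversiveCoordinates
    = (2# ∷ 0# ∷ 0#   ∷ 0#   ∷ 1#   ∷ [])
    ∷ (2# ∷ 0# ∷ 0#   ∷ 0#   ∷ - 1# ∷ [])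
    ∷ (1# ∷ 1# ∷ √2   ∷ 0#   ∷ 0#   ∷ [])
    ∷ (1# ∷ 1# ∷ 0#   ∷ √2   ∷ 0#   ∷ [])
    ∷ (0# ∷ 2# ∷ 0#   ∷ 0#   ∷ - 1# ∷ [])
    ∷ (0# ∷ 2# ∷ 0#   ∷ 0#   ∷ 1#   ∷ [])
    ∷ (1# ∷ 1# ∷ - √2 ∷ 0#   ∷ 0#   ∷ [])
    ∷ (1# ∷ 1# ∷ 0#   ∷ - √2 ∷ 0#   ∷ [])
    ∷ []

  module _ where
    open Algebra.Properties.Ring ring
    open NatSolver commutativeSemiring
    open SetoidReasoning setoid

    private
      r1 : 1# ⁻¹ ≈ 1#
      r1 = inverse-unique (*-identityˡ 1#)

      b1 : (1# ⁻¹) ⁻¹ ≈ 1#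
      b1 = inverse-unique (trans (*-identityʳ _) r1)

      r½ : ½ ⁻¹ ≈ 2#
      r½ = inverse-unique (trans (*-comm ½ 2#) 2*½≈1)

      b½ : (½ ⁻¹) ⁻¹ ≈ ½
      b½ = inverse-unique (trans (*-congʳ r½) 2*½≈1)

      square- : ∀ x → - x * - x ≈ x * x
      square- x = trans (sym (-‿distribˡ-* x (- x)))
        (trans (-‿cong (sym (-‿distribʳ-* x x))) (-‿involutive (x * x)))

      -√2*-√2≈2 : - √2 * - √2 ≈ 2#
      -√2*-√2≈2 = trans (square- √2) √2*√2≈2

      a1 : ∀ {N} → N ≈ 2# → 1# ⁻¹ * N - (1# ⁻¹) ⁻¹ ≈ 1#
      a1 {N} N≈2 = begin
        1# ⁻¹ * N - (1# ⁻¹) ⁻¹  ≈⟨ +-cong (*-cong r1 N≈2) (-‿cong b1) ⟩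
        1# * 2# - 1#            ≈⟨ +-congʳ (*-identityˡ 2#) ⟩
        1# + 1# - 1#            ≈⟨ +-assoc _ _ _ ⟩
        1# + (1# - 1#)          ≈⟨ +-congˡ (-‿inverseʳ 1#) ⟩
        1# + 0#                 ≈⟨ +-identityʳ 1# ⟩
        1#                      ∎

      a½ : ∀ {N} → N ≈ ½ * ½ → ½ ⁻¹ * N - (½ ⁻¹) ⁻¹ ≈ 0#
      a½ {N} N≈¼ = begin
        ½ ⁻¹ * N - (½ ⁻¹) ⁻¹  ≈⟨ +-cong (*-cong r½ N≈¼) (-‿cong b½) ⟩
        2# * (½ * ½) - ½      ≈⟨ +-congʳ (*-assoc 2# ½ ½) ⟨
        2# * ½ * ½ - ½        ≈⟨ +-congʳ (trans (*-congʳ 2*½≈1) (*-identityˡ ½)) ⟩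
        ½ - ½                 ≈⟨ -‿inverseʳ ½ ⟩
        0#                    ∎

      n₁ : ∀ {x m} → x * x ≈ m → ∣ x ∷ 0# ∷ 0# ∷ [] ∣² ≈ m
      n₁ {x} p = trans (solve 1 (λ x → x :* x :+ (con 0 :* con 0 :+ (con 0 :* con 0 :+ con 0)) := x :* x) refl x) p

      n₂ : ∀ {x m} → x * x ≈ m → ∣ 0# ∷ x ∷ 0# ∷ [] ∣² ≈ m
      n₂ {x} p = trans (solve 1 (λ x → con 0 :* con 0 :+ (x :* x :+ (con 0 :* con 0 :+ con 0)) := x :* x) refl x) p

      n₃ : ∀ {x m} → x * x ≈ m → ∣ 0# ∷ 0# ∷ x ∷ [] ∣² ≈ m
      n₃ {x} p = trans (solve 1 (λ x → con 0 :* con 0 :+ (con 0 :* con 0 :+ (x :* x :+ con 0)) := x :* x) refl x) p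

      t1 : ∀ x → 1# ⁻¹ * x ≈ x
      t1 x = trans (*-congʳ r1) (*-identityˡ x)

      t½ : ½ ⁻¹ * ½ ≈ 1#
      t½ = trans (*-congʳ r½) 2*½≈1

      t-½ : ½ ⁻¹ * - ½ ≈ - 1#
      t-½ = trans (sym (-‿distribʳ-* (½ ⁻¹) ½)) (-‿cong t½)

    inversiveCoordinates-𝒱₀ : ∀ i → inversiveCoordinates (𝒱₀ i) ≋ 𝒱₀-inversiveCoordinates i
    inversiveCoordinates-𝒱₀ 0F 0F = *-identityʳ 2#
    inversiveCoordinates-𝒱₀ 0F 1F = refl
    inversiveCoordinates-𝒱₀ 0F 2F = refl
    inversiveCoordinates-𝒱₀ 0F 3F = refl
    inversiveCoordinates-𝒱₀ 0F 4F = refl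
    inversiveCoordinates-𝒱₀ 1F 0F = *-identityʳ 2#
    inversiveCoordinates-𝒱₀ 1F 1F = refl
    inversiveCoordinates-𝒱₀ 1F 2F = refl
    inversiveCoordinates-𝒱₀ 1F 3F = refl
    inversiveCoordinates-𝒱₀ 1F 4F = refl
    inversiveCoordinates-𝒱₀ 2F 0F = a1 (n₁ √2*√2≈2)
    inversiveCoordinates-𝒱₀ 2F 1F = r1
    inversiveCoordinates-𝒱₀ 2F 2F = t1 √2
    inversiveCoordinates-𝒱₀ 2F 3F = zeroʳ _
    inversiveCoordinates-𝒱₀ 2F 4F = zeroʳ _
    inversiveCoordinates-𝒱₀ 3F 0F = a1 (n₂ √2*√2≈2)
    inversiveCoordinates-𝒱₀ 3F 1F = r1
    inversiveCoordinates-𝒱₀ 3F 2F = zeroʳ _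
    inversiveCoordinates-𝒱₀ 3F 3F = t1 √2
    inversiveCoordinates-𝒱₀ 3F 4F = zeroʳ _
    inversiveCoordinates-𝒱₀ 4F 0F = a½ (n₃ (square- ½))
    inversiveCoordinates-𝒱₀ 4F 1F = r½
    inversiveCoordinates-𝒱₀ 4F 2F = zeroʳ _
    inversiveCoordinates-𝒱₀ 4F 3F = zeroʳ _
    inversiveCoordinates-𝒱₀ 4F 4F = t-½
    inversiveCoordinates-𝒱₀ 5F 0F = a½ (n₃ refl)
    inversiveCoordinates-𝒱₀ 5F 1F = r½
    inversiveCoordinates-𝒱₀ 5F 2F = zeroʳ _
    inversiveCoordinates-𝒱₀ 5F 3F = zeroʳ _
    inversiveCoordinates-𝒱₀ 5F 4F = t½
    inversiveCoordinates-𝒱₀ 6F 0F = a1 (n₁ -√2*-√2≈2)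
    inversiveCoordinates-𝒱₀ 6F 1F = r1
    inversiveCoordinates-𝒱₀ 6F 2F = t1 (- √2)
    inversiveCoordinates-𝒱₀ 6F 3F = zeroʳ _
    inversiveCoordinates-𝒱₀ 6F 4F = zeroʳ _
    inversiveCoordinates-𝒱₀ 7F 0F = a1 (n₂ -√2*-√2≈2)
    inversiveCoordinates-𝒱₀ 7F 1F = r1
    inversiveCoordinates-𝒱₀ 7F 2F = zeroʳ _
    inversiveCoordinates-𝒱₀ 7F 3F = t1 (- √2)
    inversiveCoordinates-𝒱₀ 7F 4F = zeroʳ _

  -- The permutation π makes 𝒱 an arbitrary ordering of the image of 𝒱₀.

  OrthoplicialPlatonic : Pred (Vector OrientedSphere 8) 0ℓ
  OrthoplicialPlatonic 𝒱 =
    Σ (ℝ̂³ → ℝ̂³) λ f → IsMöbius f ×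
    Σ (Permutation′ 8) λ π → ∀ i → f Maps 𝒱₀ (π ⟨$⟩ʳ i) To 𝒱 i

  -- The indices 1, …, 8 become 0F, …, 7F, which does not affect i ≡ j (mod 4).

  Admissible : Pred (Vector OrientedSphere 8) 0ℓ
  Admissible 𝒱 = ∀ i j → i ≢ j →
    (toℕ i % 4 ≢ toℕ j % 4 → Tangent  (𝒱 i) (𝒱 j)) ×
    (toℕ i % 4 ≡ toℕ j % 4 → Disjoint (𝒱 i) (𝒱 j))

  V-matrix : Vector OrientedSphere 8 → Matrix 8 5
  V-matrix 𝒱 i = inversiveCoordinates (𝒱 i)

  antipodalVector : Vector OrientedSphere 8 → Vector Carrier 5
  antipodalVector 𝒱 = ½ *ᵛ (V-matrix 𝒱 0F +ᵛ V-matrix 𝒱 4F)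

  F-matrix : Vector OrientedSphere 8 → Matrix 5 5
  F-matrix 𝒱 = V-matrix 𝒱 0F ∷ V-matrix 𝒱 1F ∷ V-matrix 𝒱 2F ∷ V-matrix 𝒱 3F
             ∷ antipodalVector 𝒱 ∷ []

  D : Matrix 8 5
  D = (1#   ∷ 0#   ∷ 0#   ∷ 0#   ∷ 0# ∷ [])
    ∷ (0#   ∷ 1#   ∷ 0#   ∷ 0#   ∷ 0# ∷ [])
    ∷ (0#   ∷ 0#   ∷ 1#   ∷ 0#   ∷ 0# ∷ [])
    ∷ (0#   ∷ 0#   ∷ 0#   ∷ 1#   ∷ 0# ∷ [])
    ∷ (- 1# ∷ 0#   ∷ 0#   ∷ 0#   ∷ 2# ∷ [])
    ∷ (0#   ∷ - 1# ∷ 0#   ∷ 0#   ∷ 2# ∷ [])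
    ∷ (0#   ∷ 0#   ∷ - 1# ∷ 0#   ∷ 2# ∷ [])
    ∷ (0#   ∷ 0#   ∷ 0#   ∷ - 1# ∷ 2# ∷ [])
    ∷ []

{-# OPTIONS --safe #-}
module Submission where

open import Defs
open import Level using (0ℓ)
open import Algebra.Bundles using (CommutativeRing; RawRing)
import Algebra.Properties.AbelianGroup
import Algebra.Properties.Ring
import Algebra.Properties.Semiring.Mult.TCOptimised
import Algebra.Solver.Ring
open import Algebra.Solver.Ring.AlmostCommutativeRing
  using (_-Raw-AlmostCommutative⟶_; fromCommutativeRing)
open import Data.Bool.Base using (Bool; T)
open import Data.Fin.Base using (Fin; zero; suc; toℕ)
open import Data.Fin.Patterns
open import Data.Fin.Permutation using (_⟨$⟩ʳ_)
import Data.Fin.Properties as Fin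
open import Data.Integer.Base as ℤ using (ℤ; +_; -[1+_]; _⊖_; _◃_)
import Data.Integer.Properties as ℤ
open import Data.List.Base as List using (List; foldr)
open import Data.Maybe using (Maybe; just; map; is-just; to-witness-T)
open import Data.Maybe.Relation.Binary.Pointwise using (just; nothing)
open import Data.Nat.Base as ℕ using (zero; suc)
open import Data.Nat.DivMod using (_%_)
import Data.Nat.Properties as ℕ
open import Data.Product.Base using (∃-syntax; _×_; _,_; proj₁; proj₂)
import Data.Sign.Base as Sign
open import Data.Sum.Base using (_⊎_; inj₁; inj₂)
open import Data.Unit.Base using (tt)
import Data.Vec.Base as Vec
open import Data.Vec.Functional using (Vector; []; _∷_)
open import Function.Bundles using (module Injection)
open import Function.Properties.Inverse using (↔⇒↣)
open import Relation.Binary.Consequences using (dec⇒weaklyDec)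
open import Relation.Binary.Core using (Rel)
open import Relation.Binary.PropositionalEquality.Core as ≡ using (_≡_; _≢_)
import Relation.Binary.Reasoning.Setoid as SetoidReasoning
open import Relation.Nullary using (Dec; yes; no; ¬_; contradiction)
open import Relation.Nullary.Decidable using (toWitness; _⊎-dec_; T?)

-- For coordinates v = (a, b, x) the form Q v p = b |p|² + a - 2 x · p is zero
-- on the sphere and negative on its orienting region.  Inversion in S
-- multiplies Q by a positive factor once v is replaced by its Lorentz
-- reflection in the vector of S, a linear map preserving |x|² - a b.  Since
-- zeros and signs of Q, together with |x|² - a b = 1, determine v, a Möbius
-- transformation acts on coordinate vectors by one linear map.  It therefore
-- suffices that spheres S_i, S_j with i ≡ j (mod 4) come from a pair of 𝒱₀
-- whose vectors add up to (2, 2, 0, 0, 0): any other pair of distinct spheres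
-- of 𝒱₀ has Lorentz product -1, hence a common point, whereas S_i and S_j are
-- disjoint.

-- A ring solver with integer coefficients

module IntegerCoefficients {r₁ r₂} (R : CommutativeRing r₁ r₂) where
  open CommutativeRing R
  open Algebra.Properties.Ring ring
  open Algebra.Properties.AbelianGroup +-abelianGroup using (⁻¹-∙-comm)
  open Algebra.Properties.Semiring.Mult.TCOptimised semiring renaming (_×_ to _×′_)
  open SetoidReasoning setoid

  -- The optimised multiple `_×′_` sends 1 and 2 to `1#` and `1# + 1#` definitionally, so
  -- `con (+ 1)` and `con (+ 2)` in solver terms denote `1#` and `2#` and goals close by `refl`.
  fromℤ : ℤ → Carrier
  fromℤ (+ n)      = n ×′ 1#
  fromℤ (-[1+ n ]) = - (suc n ×′ 1#)

  fromℤ-⊖ : ∀ m n → fromℤ (m ⊖ n) ≈ m ×′ 1# - n ×′ 1#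
  fromℤ-⊖ zero zero       = sym (-‿inverseʳ 0#)
  fromℤ-⊖ zero (suc n)    = sym (+-identityˡ _)
  fromℤ-⊖ (suc m) zero    = sym (trans (+-congˡ -0#≈0#) (+-identityʳ _))
  fromℤ-⊖ (suc m) (suc n) = begin
    fromℤ (suc m ⊖ suc n)                  ≡⟨ ≡.cong fromℤ (ℤ.[1+m]⊖[1+n]≡m⊖n m n) ⟩
    fromℤ (m ⊖ n)                          ≈⟨ fromℤ-⊖ m n ⟩
    x - y                                  ≈⟨ +-congʳ (+-identityʳ x) ⟨
    -- Inserting 1 - 1 supplies the extra unit that each of the two successors carries.
    x + 0# - y                             ≈⟨ +-congʳ (+-congˡ (-‿inverseʳ 1#)) ⟨
    x + (1# - 1#) - y                      ≈⟨ +-congʳ (+-assoc x 1# (- 1#)) ⟨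
    x + 1# - 1# - y                        ≈⟨ +-assoc (x + 1#) (- 1#) (- y) ⟩
    x + 1# + (- 1# - y)                    ≈⟨ +-cong (+-comm x 1#) (⁻¹-∙-comm 1# y) ⟩
    1# + x - (1# + y)                      ≈⟨ +-cong (1+× m 1#) (-‿cong (1+× n 1#)) ⟨
    suc m ×′ 1# - suc n ×′ 1#                ∎
    where
    x = m ×′ 1#
    y = n ×′ 1#

  fromℤ-+ : ∀ i j → fromℤ (i ℤ.+ j) ≈ fromℤ i + fromℤ j
  fromℤ-+ (+ m)    (+ n)    = ×-homo-+ 1# m n
  fromℤ-+ (+ m)    -[1+ n ] = fromℤ-⊖ m (suc n)
  fromℤ-+ -[1+ m ] (+ n)    = trans (fromℤ-⊖ n (suc m)) (+-comm _ _)
  fromℤ-+ -[1+ m ] -[1+ n ] = begin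
    - (suc (suc (m ℕ.+ n)) ×′ 1#)     ≡⟨ ≡.cong (λ k → - (suc k ×′ 1#)) (ℕ.+-suc m n) ⟨
    - ((suc m ℕ.+ suc n) ×′ 1#)       ≈⟨ -‿cong (×-homo-+ 1# (suc m) (suc n)) ⟩
    - (suc m ×′ 1# + suc n ×′ 1#)      ≈⟨ ⁻¹-∙-comm _ _ ⟨
    - (suc m ×′ 1#) - suc n ×′ 1#      ∎

  -- An integer product computes to a sign attached to a natural number; this lemma and the next let
  -- `fromℤ-*` read off such a term.
  fromℤ-+◃ : ∀ n → fromℤ (Sign.+ ◃ n) ≈ n ×′ 1#
  fromℤ-+◃ zero    = refl
  fromℤ-+◃ (suc n) = refl

  fromℤ--◃ : ∀ n → fromℤ (Sign.- ◃ n) ≈ - (n ×′ 1#)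
  fromℤ--◃ zero    = sym -0#≈0#
  fromℤ--◃ (suc n) = refl

  fromℤ-* : ∀ i j → fromℤ (i ℤ.* j) ≈ fromℤ i * fromℤ j
  fromℤ-* (+ m)    (+ n)    = trans (fromℤ-+◃ (m ℕ.* n)) (×1-homo-* m n)
  fromℤ-* (+ m)    -[1+ n ] = trans (fromℤ--◃ (m ℕ.* suc n))
    (trans (-‿cong (×1-homo-* m (suc n))) (-‿distribʳ-* _ _))
  fromℤ-* -[1+ m ] (+ n)    = trans (fromℤ--◃ (suc m ℕ.* n))
    (trans (-‿cong (×1-homo-* (suc m) n)) (-‿distribˡ-* _ _))
  fromℤ-* -[1+ m ] -[1+ n ] = begin
    (suc m ℕ.* suc n) ×′ 1#            ≈⟨ ×1-homo-* (suc m) (suc n) ⟩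
    suc m ×′ 1# * suc n ×′ 1#           ≈⟨ -‿involutive _ ⟨
    - - (suc m ×′ 1# * suc n ×′ 1#)     ≈⟨ -‿cong (-‿distribʳ-* _ _) ⟩
    - (suc m ×′ 1# * - (suc n ×′ 1#))   ≈⟨ -‿distribˡ-* _ _ ⟩
    - (suc m ×′ 1#) * - (suc n ×′ 1#)   ∎

  fromℤ-neg : ∀ i → fromℤ (ℤ.- i) ≈ - fromℤ i
  fromℤ-neg (+ zero)  = sym -0#≈0#
  fromℤ-neg (+ suc n) = refl
  fromℤ-neg -[1+ n ]  = sym (-‿involutive _)

  ℤ-rawRing : RawRing 0ℓ 0ℓ
  ℤ-rawRing = record
    { Carrier = ℤ ; _≈_ = ≡._≡_ ; _+_ = ℤ._+_ ; _*_ = ℤ._*_ ; -_ = ℤ.-_ ; 0# = + 0 ; 1# = + 1 }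

  homomorphism : ℤ-rawRing -Raw-AlmostCommutative⟶ fromCommutativeRing R
  homomorphism = record
    { ⟦_⟧    = fromℤ
    ; +-homo = fromℤ-+
    ; *-homo = fromℤ-*
    ; -‿homo = fromℤ-neg
    ; 0-homo = refl
    ; 1-homo = refl
    }

  _≟-fromℤ_ : ∀ i j → Maybe (fromℤ i ≈ fromℤ j)
  i ≟-fromℤ j = map (λ { ≡.refl → refl }) (dec⇒weaklyDec ℤ._≟_ i j)

  open Algebra.Solver.Ring ℤ-rawRing (fromCommutativeRing R) homomorphism _≟-fromℤ_ public

-- Ordered fields

module OrderedField (ℝ : CompleteOrderedField) where
  open CompleteOrderedField ℝ
  open Arithmetic ℝ
  open IntegerCoefficients commutativeRing

  x-x≈0 : ∀ {x y} → x ≈ y → x - y ≈ 0#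
  x-x≈0 {x} {y} x≈y = trans (+-congʳ x≈y) (-‿inverseʳ y)

  x-y≈0⇒x≈y : ∀ {x y} → x - y ≈ 0# → x ≈ y
  x-y≈0⇒x≈y {x} {y} p =
    trans (solve 2 (λ x y → x := x :- y :+ y) refl x y) (trans (+-congʳ p) (+-identityˡ y))

  -- The solver knows no hypotheses. Identities that hold modulo an equation `e ≈ 0#` are therefore
  -- solved with an explicit multiple of `e` added, which is then discarded here.
  absorb : ∀ {x c e} → e ≈ 0# → x + c * e ≈ x
  absorb {x} {c} p = trans (+-congˡ (trans (*-congˡ p) (zeroʳ c))) (+-identityʳ x)

  x*y≈0⇒y≈0 : ∀ {x y} → ¬ x ≈ 0# → x * y ≈ 0# → y ≈ 0#
  x*y≈0⇒y≈0 {x} {y} x≉0 p = trans (sym (*-identityˡ y)) (trans (*-congʳ (sym (⁻¹-inverseʳ x≉0)))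
    (trans (solve 3 (λ x y i → x :* i :* y := i :* (x :* y)) refl x y (x ⁻¹))
      (trans (*-congˡ p) (zeroʳ _))))

  0≤x*x : ∀ x → 0# ≤ x * x
  0≤x*x x with ≤-total 0# x
  ... | inj₁ 0≤x = *-nonneg 0≤x 0≤x
  ... | inj₂ x≤0 = ≤-respʳ-≈ (solve 1 (λ x → :- x :* :- x := x :* x) refl x)
                     (*-nonneg (≤0⇒0≤- x≤0) (≤0⇒0≤- x≤0))

  x*x≈0⇒x≈0 : ∀ {x} → x * x ≈ 0# → x ≈ 0#
  x*x≈0⇒x≈0 {x} p with x ≟ 0#
  ... | yes x≈0 = x≈0
  ... | no x≉0  = x*y≈0⇒y≈0 x≉0 p

  x+y≈0⇒x≈0 : ∀ {x y} → 0# ≤ x → 0# ≤ y → x + y ≈ 0# → x ≈ 0#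
  x+y≈0⇒x≈0 0≤x 0≤y p = ≤-antisym (≤-respʳ-≈ p (x≤x+nonneg 0≤y)) 0≤x

  x+y≈0⇒y≈0 : ∀ {x y} → 0# ≤ x → 0# ≤ y → x + y ≈ 0# → y ≈ 0#
  x+y≈0⇒y≈0 0≤x 0≤y p = x+y≈0⇒x≈0 0≤y 0≤x (trans (+-comm _ _) p)

  Positive : Carrier → Set
  Positive x = 0# < x

  positive-resp : ∀ {x y} → x ≈ y → Positive x → Positive y
  positive-resp x≈y (0≤x , 0≉x) = ≤-respʳ-≈ x≈y 0≤x , λ 0≈y → 0≉x (trans 0≈y (sym x≈y))

  positive⇒≉0 : ∀ {x} → Positive x → ¬ x ≈ 0#
  positive⇒≉0 (_ , 0≉x) x≈0 = 0≉x (sym x≈0)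

  0<1 : Positive 1#
  0<1 = 0≤1 , λ p → 1≉0 (sym p)

  0<2 : Positive 2#
  0<2 = 0≤2 , λ p → 2≉0 (sym p)

  *-positive : ∀ {x y} → Positive x → Positive y → Positive (x * y)
  *-positive 0<x 0<y = *-nonneg (proj₁ 0<x) (proj₁ 0<y) ,
    λ p → positive⇒≉0 0<y (x*y≈0⇒y≈0 (positive⇒≉0 0<x) (sym p))

  -- If `y` were at most 0, then `x * y` and `x * - y` would be nonnegative with sum 0, forcing
  -- `x * y` to vanish.
  *-cancelˡ-positive : ∀ {x y} → Positive x → Positive (x * y) → Positive y
  *-cancelˡ-positive {x} {y} 0<x 0<xy with ≤-total 0# y
  ... | inj₁ 0≤y = 0≤y , λ p → positive⇒≉0 0<xy (trans (*-congˡ (sym p)) (zeroʳ x))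
  ... | inj₂ y≤0 = contradiction
          (x+y≈0⇒x≈0 (proj₁ 0<xy) (*-nonneg (proj₁ 0<x) (≤0⇒0≤- y≤0))
            (solve 2 (λ x y → x :* y :+ x :* :- y := con (+ 0)) refl x y))
          (positive⇒≉0 0<xy)

  square-positive : ∀ {x} → ¬ x ≈ 0# → Positive (x * x)
  square-positive x≉0 = 0≤x*x _ , λ p → x≉0 (x*x≈0⇒x≈0 (sym p))

  inverse-positive : ∀ {x y} → Positive x → x * y ≈ 1# → Positive y
  inverse-positive 0<x p = *-cancelˡ-positive 0<x (positive-resp (sym p) 0<1)

  <⇒positive : ∀ {x y} → x < y → Positive (y - x)
  <⇒positive (x≤y , x≉y) = ≤⇒0≤- x≤y , λ p → x≉y (sym (x-y≈0⇒x≈y (sym p)))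

  positive⇒< : ∀ {x y} → Positive (y - x) → x < y
  positive⇒< {x} {y} (0≤ , 0≉) =
    ≤-respʳ-≈ (solve 2 (λ x y → x :+ (y :- x) := y) refl x y) (x≤x+nonneg 0≤) ,
    λ p → 0≉ (sym (x-x≈0 (sym p)))

  <0⇒positive : ∀ {x} → x < 0# → Positive (- x)
  <0⇒positive x<0 = positive-resp (+-identityˡ _) (<⇒positive x<0)

  positive⇒<0 : ∀ {x} → Positive (- x) → x < 0#
  positive⇒<0 p = positive⇒< (positive-resp (sym (+-identityˡ _)) p)

  <-dichotomy : ∀ {x} → ¬ x ≈ 0# → Positive x ⊎ x < 0#
  <-dichotomy {x} x≉0 with ≤-total 0# x
  ... | inj₁ 0≤x = inj₁ (0≤x , λ p → x≉0 (sym p))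
  ... | inj₂ x≤0 = inj₂ (x≤0 , x≉0)

  -- Settles the sign that a norm condition leaves open when a vector is recovered from its form.
  positive-square≈1 : ∀ {x} → Positive x → x * x ≈ 1# → x ≈ 1#
  positive-square≈1 {x} 0<x p = x-y≈0⇒x≈y (x*y≈0⇒y≈0 x+1≉0
    (trans (solve 1 (λ x → (x :+ con (+ 1)) :* (x :- con (+ 1)) := x :* x :- con (+ 1)) refl x)
      (x-x≈0 p)))
    where
    x+1≉0 : ¬ x + 1# ≈ 0#
    x+1≉0 q = positive⇒≉0 0<x (x+y≈0⇒x≈0 (proj₁ 0<x) 0≤1 q)

  infix 4 _∼_

  -- Equality up to a positive factor: coarse enough for the conformal factor of an inversion, fine
  -- enough to keep zeros and signs.
  _∼_ : Rel Carrier 0ℓ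
  x ∼ y = ∃[ t ] Positive t × x ≈ t * y

  ∼-reflexive : ∀ {x y} → x ≈ y → x ∼ y
  ∼-reflexive p = 1# , 0<1 , trans p (sym (*-identityˡ _))

  ∼-trans : ∀ {x y z} → x ∼ y → y ∼ z → x ∼ z
  ∼-trans (s , 0<s , p) (t , 0<t , q) =
    s * t , *-positive 0<s 0<t , trans p (trans (*-congˡ q) (sym (*-assoc s t _)))

  ∼-≈0 : ∀ {x y} → x ∼ y → y ≈ 0# → x ≈ 0#
  ∼-≈0 (t , _ , p) q = trans p (trans (*-congˡ q) (zeroʳ t))

  ∼-<0 : ∀ {x y} → x ∼ y → y < 0# → x < 0#
  ∼-<0 {x} {y} (t , 0<t , p) q = positive⇒<0 (positive-resp
    (trans (solve 2 (λ t y → t :* :- y := :- (t :* y)) refl t y) (-‿cong (sym p)))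
    (*-positive 0<t (<0⇒positive q)))

-- Inversive geometry

module Geometry (ℝ : CompleteOrderedField) where
  open CompleteOrderedField ℝ
  open Arithmetic ℝ
  open Inversive ℝ
  open OrderedField ℝ
  open IntegerCoefficients commutativeRing
  open SetoidReasoning setoid

  -- Dot products in three-dimensional space

  private
    -- The trailing zero matches the unfolding of `sum`, so that the interpretation of this
    -- polynomial is definitionally a dot product.
    _⊙_ : ∀ {n} → Vector (Polynomial n) 3 → Vector (Polynomial n) 3 → Polynomial n
    x ⊙ y = x 0F :* y 0F :+ (x 1F :* y 1F :+ (x 2F :* y 2F :+ con (+ 0)))

  ·-cong : {x x′ y y′ : ℝ³} → x ≋ x′ → y ≋ y′ → x · y ≈ x′ · y′
  ·-cong p q = +-cong (*-cong (p 0F) (q 0F)) (+-cong (*-cong (p 1F) (q 1F))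
    (+-congʳ (*-cong (p 2F) (q 2F))))

  ·-comm : (x y : ℝ³) → x · y ≈ y · x
  ·-comm x y = solve 6 (λ x₀ x₁ x₂ y₀ y₁ y₂ →
    let x = x₀ ∷ x₁ ∷ x₂ ∷ [] ; y = y₀ ∷ y₁ ∷ y₂ ∷ []
    in x ⊙ y := y ⊙ x) refl (x 0F) (x 1F) (x 2F) (y 0F) (y 1F) (y 2F)

  ·-linear : (x y z : ℝ³) (t : Carrier) → (x +ᵛ t *ᵛ y) · z ≈ x · z + t * (y · z)
  ·-linear x y z t = solve 10 (λ x₀ x₁ x₂ y₀ y₁ y₂ z₀ z₁ z₂ t →
    let x = x₀ ∷ x₁ ∷ x₂ ∷ [] ; y = y₀ ∷ y₁ ∷ y₂ ∷ [] ; z = z₀ ∷ z₁ ∷ z₂ ∷ []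
    in (λ i → x i :+ t :* y i) ⊙ z := x ⊙ z :+ t :* (y ⊙ z)) refl
    (x 0F) (x 1F) (x 2F) (y 0F) (y 1F) (y 2F) (z 0F) (z 1F) (z 2F) t

  ·-*ᵛ : (t : Carrier) (x y : ℝ³) → (t *ᵛ x) · y ≈ t * (x · y)
  ·-*ᵛ t x y = solve 7 (λ x₀ x₁ x₂ y₀ y₁ y₂ t →
    let x = x₀ ∷ x₁ ∷ x₂ ∷ [] ; y = y₀ ∷ y₁ ∷ y₂ ∷ []
    in (λ i → t :* x i) ⊙ y := t :* (x ⊙ y)) refl
    (x 0F) (x 1F) (x 2F) (y 0F) (y 1F) (y 2F) t

  ·-*ᵛʳ : (t : Carrier) (x y : ℝ³) → x · (t *ᵛ y) ≈ t * (x · y)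
  ·-*ᵛʳ t x y = trans (·-comm x (t *ᵛ y)) (trans (·-*ᵛ t y x) (*-congˡ (·-comm y x)))

  ·-linearʳ : (x y z : ℝ³) (t : Carrier) → z · (x +ᵛ t *ᵛ y) ≈ z · x + t * (z · y)
  ·-linearʳ x y z t = trans (·-comm z (x +ᵛ t *ᵛ y))
    (trans (·-linear x y z t) (+-cong (·-comm x z) (*-congˡ (·-comm y z))))

  -ᵛ≋+ᵛ : ∀ {n} (x y : Vector Carrier n) t → x -ᵛ t *ᵛ y ≋ x +ᵛ (- t) *ᵛ y
  -ᵛ≋+ᵛ x y t i = solve 3 (λ x y t → x :- t :* y := x :+ (:- t) :* y) refl (x i) (y i) t

  ∣∣²-line : (x y : ℝ³) (t : Carrier) → ∣ x +ᵛ t *ᵛ y ∣² ≈ ∣ x ∣² + 2# * t * (x · y) + t * t * ∣ y ∣²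
  ∣∣²-line x y t = begin
    (x +ᵛ t *ᵛ y) · (x +ᵛ t *ᵛ y)
      ≈⟨ ·-linear x y (x +ᵛ t *ᵛ y) t ⟩
    x · (x +ᵛ t *ᵛ y) + t * (y · (x +ᵛ t *ᵛ y))
      ≈⟨ +-cong (·-linearʳ x y x t) (*-congˡ (trans (·-linearʳ x y y t) (+-congʳ (·-comm y x)))) ⟩
    (∣ x ∣² + t * (x · y)) + t * (x · y + t * ∣ y ∣²)
      ≈⟨ solve 4 (λ a b c t → (a :+ t :* b) :+ t :* (b :+ t :* c) := a :+ con (+ 2) :* t :* b :+ t :* t :* c)
           refl ∣ x ∣² (x · y) ∣ y ∣² t ⟩
    ∣ x ∣² + 2# * t * (x · y) + t * t * ∣ y ∣² ∎

  ∣-ᵛ∣² : (x y : ℝ³) → ∣ x -ᵛ y ∣² ≈ ∣ x ∣² - 2# * (x · y) + ∣ y ∣²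
  ∣-ᵛ∣² x y = solve 6 (λ x₀ x₁ x₂ y₀ y₁ y₂ →
    let x = x₀ ∷ x₁ ∷ x₂ ∷ [] ; y = y₀ ∷ y₁ ∷ y₂ ∷ [] ; d = λ i → x i :- y i
    in d ⊙ d := x ⊙ x :- con (+ 2) :* (x ⊙ y) :+ y ⊙ y) refl
    (x 0F) (x 1F) (x 2F) (y 0F) (y 1F) (y 2F)

  0≤∣∣² : (x : ℝ³) → 0# ≤ ∣ x ∣²
  0≤∣∣² x = +-nonneg (0≤x*x (x 0F)) (+-nonneg (0≤x*x (x 1F)) (+-nonneg (0≤x*x (x 2F)) ≤-refl))

  ∣x∣²≈0⇒x≋0 : {x : ℝ³} → ∣ x ∣² ≈ 0# → ∀ i → x i ≈ 0#
  ∣x∣²≈0⇒x≋0 {x} p = λ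
    { 0F → x*x≈0⇒x≈0 (x+y≈0⇒x≈0 (0≤x*x _) 0≤₁ p)
    ; 1F → x*x≈0⇒x≈0 (x+y≈0⇒x≈0 (0≤x*x _) 0≤₂ p₁)
    ; 2F → x*x≈0⇒x≈0 (x+y≈0⇒x≈0 (0≤x*x _) ≤-refl (x+y≈0⇒y≈0 (0≤x*x _) 0≤₂ p₁))
    }
    where
    0≤₂ = +-nonneg (0≤x*x (x 2F)) ≤-refl
    0≤₁ = +-nonneg (0≤x*x (x 1F)) 0≤₂
    p₁ = x+y≈0⇒y≈0 (0≤x*x (x 0F)) 0≤₁ p

  -- The form whose zeros and signs describe an oriented sphere

  spatial : Vector Carrier 5 → ℝ³
  spatial v i = v (suc (suc i))

  -- The value at `∞` is the leading coefficient, the limit of the form divided by |x|².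
  Q : Vector Carrier 5 → ℝ̂³ → Carrier
  Q v (just x) = v 1F * ∣ x ∣² + v 0F - 2# * (spatial v · x)
  Q v ∞        = v 1F

  Q-cong : ∀ {v w p q} → v ≋ w → p ≈̂ q → Q v p ≈ Q w q
  Q-cong v≋w nothing    = v≋w 1F
  Q-cong v≋w (just x≋y) = +-cong (+-cong (*-cong (v≋w 1F) (·-cong x≋y x≋y)) (v≋w 0F))
    (-‿cong (*-congˡ (·-cong (λ i → v≋w (suc (suc i))) x≋y)))

  Q-congʳ : ∀ v {p q} → p ≈̂ q → Q v p ≈ Q v q
  Q-congʳ v = Q-cong {v = v} λ _ → refl

  -- On a line the form is a quadratic polynomial in the parameter. This serves both to sample it at
  -- chosen points and to evaluate it at inverse points, which lie on a ray from the centre or on a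
  -- normal to the plane.
  Q-line : ∀ v (x y : ℝ³) t →
    Q v (just (x +ᵛ t *ᵛ y)) ≈
    Q v (just x) + t * (2# * (v 1F * (x · y) - spatial v · y)) + t * t * (v 1F * ∣ y ∣²)
  Q-line v x y t = begin
    v 1F * ∣ x +ᵛ t *ᵛ y ∣² + v 0F - 2# * (u · (x +ᵛ t *ᵛ y))
      ≈⟨ +-cong (+-congʳ (*-congˡ (∣∣²-line x y t))) (-‿cong (*-congˡ (·-linearʳ x y u t))) ⟩
    v 1F * (∣ x ∣² + 2# * t * (x · y) + t * t * ∣ y ∣²) + v 0F - 2# * (u · x + t * (u · y))
      ≈⟨ solve 8 (λ a b X XY Y t UX UY →
           b :* (X :+ con (+ 2) :* t :* XY :+ t :* t :* Y) :+ a :- con (+ 2) :* (UX :+ t :* UY)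
           := (b :* X :+ a :- con (+ 2) :* UX) :+ t :* (con (+ 2) :* (b :* XY :- UY)) :+ t :* t :* (b :* Y))
           refl (v 0F) (v 1F) ∣ x ∣² (x · y) ∣ y ∣² t (u · x) (u · y) ⟩
    Q v (just x) + t * (2# * (v 1F * (x · y) - u · y)) + t * t * (v 1F * ∣ y ∣²) ∎
    where
    u = spatial v

  Q-sub : ∀ v w t p → Q (v -ᵛ t *ᵛ w) p ≈ Q v p - t * Q w p
  Q-sub v w t ∞        = refl
  Q-sub v w t (just x) = begin
    (v 1F - t * w 1F) * ∣ x ∣² + (v 0F - t * w 0F) - 2# * ((spatial v -ᵛ t *ᵛ spatial w) · x)
      ≈⟨ +-congˡ (-‿cong (*-congˡ (trans
           (·-cong {y = x} (-ᵛ≋+ᵛ (spatial v) (spatial w) t) λ _ → refl)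
           (·-linear (spatial v) (spatial w) x (- t))))) ⟩
    (v 1F - t * w 1F) * ∣ x ∣² + (v 0F - t * w 0F) - 2# * (spatial v · x + - t * (spatial w · x))
      ≈⟨ solve 8 (λ a b a′ b′ X t VX WX →
           (b :- t :* b′) :* X :+ (a :- t :* a′) :- con (+ 2) :* (VX :+ :- t :* WX)
           := (b :* X :+ a :- con (+ 2) :* VX) :- t :* (b′ :* X :+ a′ :- con (+ 2) :* WX))
           refl (v 0F) (v 1F) (w 0F) (w 1F) ∣ x ∣² t (spatial v · x) (spatial w · x) ⟩
    Q v (just x) - t * Q w (just x) ∎

  module _ (c : ℝ³) (r : Carrier) (r≉0 : ¬ r ≈ 0#) where
    private
      b = r ⁻¹
      r*b≈1 : r * b ≈ 1#
      r*b≈1 = ⁻¹-inverseʳ r≉0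
      b⁻¹≈r : b ⁻¹ ≈ r
      b⁻¹≈r = inverse-unique (trans (*-comm b r) r*b≈1)

    -- The form is the power of the point with respect to the sphere, multiplied by the bend; the
    -- sign of the bend accounts for the orientation.
    Q-sphere : ∀ x → Q (inversiveCoordinates (sphere c r r≉0)) (just x) ≈ b * (∣ x -ᵛ c ∣² - r * r)
    Q-sphere x = begin
      b * ∣ x ∣² + (b * ∣ c ∣² - b ⁻¹) - 2# * ((b *ᵛ c) · x)
        ≈⟨ +-cong (+-congˡ (+-congˡ (-‿cong b⁻¹≈r))) 
             (-‿cong (*-congˡ (trans (·-*ᵛ b c x) (*-congˡ (·-comm c x))))) ⟩
      b * ∣ x ∣² + (b * ∣ c ∣² - r) - 2# * (b * (x · c))
        ≈⟨ solve 5 (λ b r X C XC →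
             b :* X :+ (b :* C :- r) :- con (+ 2) :* (b :* XC)
             := b :* ((X :- con (+ 2) :* XC :+ C) :- r :* r) :+ r :* (r :* b :- con (+ 1)))
             refl b r ∣ x ∣² ∣ c ∣² (x · c) ⟩
      b * ((∣ x ∣² - 2# * (x · c) + ∣ c ∣²) - r * r) + r * (r * b - 1#)
        ≈⟨ absorb (x-x≈0 r*b≈1) ⟩
      b * ((∣ x ∣² - 2# * (x · c) + ∣ c ∣²) - r * r)
        ≈⟨ *-congˡ (+-congʳ (∣-ᵛ∣² x c)) ⟨
      b * (∣ x -ᵛ c ∣² - r * r) ∎

    bend-positive : Positive r → Positive b
    bend-positive 0<r = inverse-positive 0<r r*b≈1

    bend-negative : r < 0# → b < 0#
    bend-negative r<0 = positive⇒<0 (inverse-positive (<0⇒positive r<0)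
      (trans (solve 2 (λ r b → :- r :* :- b := r :* b) refl r b) r*b≈1))

    bend≉0 : ¬ b ≈ 0#
    bend≉0 p = 1≉0 (trans (sym r*b≈1) (trans (*-congˡ p) (zeroʳ r)))

    sphere-norm : ∣ b *ᵛ c ∣² - (b * ∣ c ∣² - b ⁻¹) * b ≈ 1#
    sphere-norm = begin
      ∣ b *ᵛ c ∣² - (b * ∣ c ∣² - b ⁻¹) * b
        ≈⟨ +-cong (trans (·-*ᵛ b c (b *ᵛ c)) (*-congˡ (·-*ᵛʳ b c c)))
             (-‿cong (*-congʳ (+-congˡ (-‿cong b⁻¹≈r)))) ⟩
      b * (b * ∣ c ∣²) - (b * ∣ c ∣² - r) * b
        ≈⟨ solve 3 (λ b r C → b :* (b :* C) :- (b :* C :- r) :* b := r :* b) refl b r ∣ c ∣² ⟩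
      r * b ≈⟨ r*b≈1 ⟩
      1# ∎

  Q-plane : ∀ n h n≈1 x → Q (inversiveCoordinates (plane n h n≈1)) (just x) ≈ 2# * (h - n · x)
  Q-plane n h _ x = solve 3 (λ X h P → con (+ 0) :* X :+ con (+ 2) :* h :- con (+ 2) :* P
    := con (+ 2) :* (h :- P)) refl ∣ x ∣² h (n · x)

  surface⇒Q≈0 : ∀ S {p} → surface S p → Q (inversiveCoordinates S) p ≈ 0#
  surface⇒Q≈0 (sphere c r r≉0) {just x} x∈S =
    trans (Q-sphere c r r≉0 x) (trans (*-congˡ (x-x≈0 x∈S)) (zeroʳ _))
  surface⇒Q≈0 (plane n h n≈1) {just x} x∈S =
    trans (Q-plane n h n≈1 x) (trans (*-congˡ (x-x≈0 (sym x∈S))) (zeroʳ _))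
  surface⇒Q≈0 (plane n h n≈1) {∞}      _   = refl

  Q≈0⇒surface : ∀ S {p} → Q (inversiveCoordinates S) p ≈ 0# → surface S p
  Q≈0⇒surface (sphere c r r≉0) {just x} q =
    x-y≈0⇒x≈y (x*y≈0⇒y≈0 (bend≉0 c r r≉0) (trans (sym (Q-sphere c r r≉0 x)) q))
  Q≈0⇒surface (sphere c r r≉0) {∞}      q = bend≉0 c r r≉0 q
  Q≈0⇒surface (plane n h n≈1) {just x} q =
    sym (x-y≈0⇒x≈y (x*y≈0⇒y≈0 2≉0 (trans (sym (Q-plane n h n≈1 x)) q)))
  Q≈0⇒surface (plane n h n≈1) {∞}      _ = tt

  region⇒Q<0 : ∀ S {p} → region S p → Q (inversiveCoordinates S) p < 0#
  region⇒Q<0 (sphere c r r≉0) {just x} (inj₁ (0<r , D<r²)) = positive⇒<0 (positive-resp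
    (trans (solve 3 (λ b D R → b :* (R :- D) := :- (b :* (D :- R))) refl (r ⁻¹) ∣ x -ᵛ c ∣² (r * r))
      (-‿cong (sym (Q-sphere c r r≉0 x))))
    (*-positive (bend-positive c r r≉0 0<r) (<⇒positive D<r²)))
  region⇒Q<0 (sphere c r r≉0) {just x} (inj₂ (r<0 , r²<D)) = positive⇒<0 (positive-resp
    (trans (solve 3 (λ b D R → :- b :* (D :- R) := :- (b :* (D :- R))) refl (r ⁻¹) ∣ x -ᵛ c ∣² (r * r))
      (-‿cong (sym (Q-sphere c r r≉0 x))))
    (*-positive (<0⇒positive (bend-negative c r r≉0 r<0)) (<⇒positive r²<D)))
  region⇒Q<0 (sphere c r r≉0) {∞} r<0 = bend-negative c r r≉0 r<0
  region⇒Q<0 (plane n h n≈1) {just x} h<n·x = positive⇒<0 (positive-resp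
    (trans (solve 2 (λ h P → con (+ 2) :* (P :- h) := :- (con (+ 2) :* (h :- P))) refl h (n · x))
      (-‿cong (sym (Q-plane n h n≈1 x))))
    (*-positive 0<2 (<⇒positive h<n·x)))

  -- The Lorentz form of signature (4,1), written in light-cone coordinates `v 0F` and `v 1F`;
  -- coordinate vectors of spheres lie on its unit level set.
  N : Vector Carrier 5 → Carrier
  N v = ∣ spatial v ∣² - v 0F * v 1F

  -- The polarisation of N, twice the Lorentz product: B v v = 2 N v.

  B : Vector Carrier 5 → Vector Carrier 5 → Carrier
  B v w = 2# * (spatial v · spatial w) - (v 0F * w 1F + v 1F * w 0F)

  B-cong : ∀ {v v′ w w′} → v ≋ v′ → w ≋ w′ → B v w ≈ B v′ w′
  B-cong p q = +-cong (*-congˡ (·-cong (λ i → p (suc (suc i))) λ i → q (suc (suc i))))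
    (-‿cong (+-cong (*-cong (p 0F) (q 1F)) (*-cong (p 1F) (q 0F))))

  N-inversiveCoordinates : ∀ S → N (inversiveCoordinates S) ≈ 1#
  N-inversiveCoordinates (sphere c r r≉0) = sphere-norm c r r≉0
  N-inversiveCoordinates (plane n h n≈1)  =
    trans (solve 2 (λ N h → N :- con (+ 2) :* h :* con (+ 0) := N) refl ∣ n ∣² h) n≈1

  -- Recovering a unit vector from the zeros and signs of its form

  private
    basis : Fin 3 → ℝ³
    basis 0F = 1# ∷ 0# ∷ 0# ∷ []
    basis 1F = 0# ∷ 1# ∷ 0# ∷ []
    basis 2F = 0# ∷ 0# ∷ 1# ∷ []

    ·-basis : ∀ (x : ℝ³) i → x · basis i ≈ x i
    ·-basis x 0F = solve 3 (λ x₀ x₁ x₂ →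
      (x₀ ∷ x₁ ∷ x₂ ∷ []) ⊙ (con (+ 1) ∷ con (+ 0) ∷ con (+ 0) ∷ []) := x₀) refl (x 0F) (x 1F) (x 2F)
    ·-basis x 1F = solve 3 (λ x₀ x₁ x₂ →
      (x₀ ∷ x₁ ∷ x₂ ∷ []) ⊙ (con (+ 0) ∷ con (+ 1) ∷ con (+ 0) ∷ []) := x₁) refl (x 0F) (x 1F) (x 2F)
    ·-basis x 2F = solve 3 (λ x₀ x₁ x₂ →
      (x₀ ∷ x₁ ∷ x₂ ∷ []) ⊙ (con (+ 0) ∷ con (+ 0) ∷ con (+ 1) ∷ []) := x₂) refl (x 0F) (x 1F) (x 2F)

    ∣basis∣²≈1 : ∀ i → ∣ basis i ∣² ≈ 1#
    ∣basis∣²≈1 0F = ·-basis (basis 0F) 0F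
    ∣basis∣²≈1 1F = ·-basis (basis 1F) 1F
    ∣basis∣²≈1 2F = ·-basis (basis 2F) 2F

  ∣+ᵛ-∣² : (x y : ℝ³) (t : Carrier) → ∣ (x +ᵛ t *ᵛ y) -ᵛ x ∣² ≈ t * t * ∣ y ∣²
  ∣+ᵛ-∣² x y t = solve 7 (λ x₀ x₁ x₂ y₀ y₁ y₂ t →
    let x = x₀ ∷ x₁ ∷ x₂ ∷ [] ; y = y₀ ∷ y₁ ∷ y₂ ∷ [] ; d = λ i → (x i :+ t :* y i) :- x i
    in d ⊙ d := t :* t :* (y ⊙ y)) refl
    (x 0F) (x 1F) (x 2F) (y 0F) (y 1F) (y 2F) t

  ∣x-x∣²≈0 : (x : ℝ³) → ∣ x -ᵛ x ∣² ≈ 0#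
  ∣x-x∣²≈0 x = solve 3 (λ x₀ x₁ x₂ →
    let x = x₀ ∷ x₁ ∷ x₂ ∷ [] ; d = λ i → x i :- x i
    in d ⊙ d := con (+ 0)) refl (x 0F) (x 1F) (x 2F)

  module _ {w} (Nw≈1 : N w ≈ 1#) where
    private
      α = w 0F
      β = w 1F
      u = spatial w

    -- The six points at distance `r` from `c` along the axes give `u` = `β c` and the value of the
    -- form at `c`. The norm then yields (`r β`)² = 1, and the sign at one point of the region
    -- selects `r β` = 1.
    determined-sphere : ∀ c r r≉0 →
      (∀ p → surface (sphere c r r≉0) p → Q w p ≈ 0#) →
      (∀ p → region (sphere c r r≉0) p → Q w p < 0#) →
      inversiveCoordinates (sphere c r r≉0) ≋ w
    determined-sphere c r r≉0 Q≈0 Q<0 = λ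
      { 0F → begin
          r ⁻¹ * ∣ c ∣² - (r ⁻¹) ⁻¹      ≈⟨ +-cong (*-congʳ r⁻¹≈β) (-‿cong (inverse-unique r⁻¹*r≈1)) ⟩
          -- Trades `r` for `r * r * β`, the shape in which `α≈` provides the entry.
          β * C - r                      ≈⟨ absorb (x-x≈0 rβ≈1) ⟨
          β * C - r + (- r) * (r * β - 1#)
            ≈⟨ solve 3 (λ β C r → β :* C :- r :+ (:- r) :* (r :* β :- con (+ 1))
                 := β :* C :- r :* r :* β) refl β C r ⟩
          β * C - r * r * β              ≈⟨ α≈ ⟨
          α                              ∎
      ; 1F → r⁻¹≈β
      ; (suc (suc i)) → trans (*-congʳ r⁻¹≈β) (sym (u≋βc i))
      }
      where
      C = ∣ c ∣²
      A = Q w (just c)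
      q = r * r * β

      on-axis : ∀ t → t * t ≈ r * r → ∀ i → A + t * (2# * (β * c i - u i)) + q ≈ 0#
      on-axis t tt≈rr i = begin
        A + t * (2# * (β * c i - u i)) + r * r * β
          ≈⟨ +-cong (+-congˡ (*-congˡ (*-congˡ (+-cong (*-congˡ (·-basis c i)) (-‿cong (·-basis u i))))))
               (*-cong tt≈rr (trans (*-congˡ (∣basis∣²≈1 i)) (*-identityʳ β))) ⟨
        A + t * (2# * (β * (c · basis i) - u · basis i)) + t * t * (β * ∣ basis i ∣²)
          ≈⟨ Q-line w c (basis i) t ⟨
        Q w (just (c +ᵛ t *ᵛ basis i))
          ≈⟨ Q≈0 (just (c +ᵛ t *ᵛ basis i)) (trans (∣+ᵛ-∣² c (basis i) t)
               (trans (*-cong tt≈rr (∣basis∣²≈1 i)) (*-identityʳ _))) ⟩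
        0# ∎

      -- Subtracting the values at two opposite points of the sphere leaves the term linear in `r`.
      u≋βc : ∀ i → u i ≈ β * c i
      u≋βc i = sym (x-y≈0⇒x≈y (x*y≈0⇒y≈0 2≉0 (x*y≈0⇒y≈0 2≉0 (x*y≈0⇒y≈0 r≉0 (begin
        r * (2# * (2# * e))
          ≈⟨ solve 4 (λ A r e q → r :* (con (+ 2) :* (con (+ 2) :* e))
               := (A :+ r :* (con (+ 2) :* e) :+ q) :- (A :+ (:- r) :* (con (+ 2) :* e) :+ q)) refl A r e q ⟩
        (A + r * (2# * e) + q) - (A + - r * (2# * e) + q)
          ≈⟨ +-cong (on-axis r refl i)
               (-‿cong (on-axis (- r) (solve 1 (λ r → :- r :* :- r := r :* r) refl r) i)) ⟩
        0# - 0#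
          ≈⟨ -‿inverseʳ 0# ⟩
        0# ∎)))))
        where e = β * c i - u i

      A≈-q : A ≈ - q
      A≈-q = begin
        A
          ≈⟨ solve 4 (λ A r e q → A
               := (A :+ r :* (con (+ 2) :* e) :+ q) :- q :+ (:- (con (+ 2) :* r)) :* e) refl A r e q ⟩
        A + r * (2# * e) + q - q + (- (2# * r)) * e
          ≈⟨ absorb (x-x≈0 (sym (u≋βc 0F))) ⟩
        A + r * (2# * e) + q - q
          ≈⟨ +-congʳ (on-axis r refl 0F) ⟩
        0# - q
          ≈⟨ +-identityˡ _ ⟩
        - q ∎
        where e = β * c 0F - u 0F

      u·c≈ : u · c ≈ β * C
      u·c≈ = trans (·-cong {y = c} u≋βc λ _ → refl) (·-*ᵛ β c c)

      α≈ : α ≈ β * C - q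
      α≈ = begin
        α
          ≈⟨ solve 4 (λ α β C P → α := (β :* C :+ α :- con (+ 2) :* P) :- β :* C :+ con (+ 2) :* P)
               refl α β C (u · c) ⟩
        A - β * C + 2# * (u · c)
          ≈⟨ +-cong (+-congʳ A≈-q) (*-congˡ u·c≈) ⟩
        - q - β * C + 2# * (β * C)
          ≈⟨ solve 2 (λ q K → :- q :- K :+ con (+ 2) :* K := K :- q) refl q (β * C) ⟩
        β * C - q ∎

      rβ-square : (r * β) * (r * β) ≈ 1#
      rβ-square = begin
        (r * β) * (r * β)
          ≈⟨ solve 3 (λ r β C → (r :* β) :* (r :* β)
               := β :* (β :* C) :- (β :* C :- r :* r :* β) :* β) refl r β C ⟩
        β * (β * C) - (β * C - q) * β
          ≈⟨ +-cong (trans (·-cong u≋βc u≋βc) (trans (·-*ᵛ β c (β *ᵛ c)) (*-congˡ (·-*ᵛʳ β c c))))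
               (-‿cong (*-congʳ α≈)) ⟨
        N w
          ≈⟨ Nw≈1 ⟩
        1# ∎

      centre-inside : ∣ c -ᵛ c ∣² < r * r
      centre-inside = positive⇒< (positive-resp
        (trans (solve 1 (λ R → R := R :- con (+ 0)) refl (r * r)) (+-congˡ (-‿cong (sym (∣x-x∣²≈0 c)))))
        (square-positive r≉0))

      -- The test point in the region is the centre for a ball and `∞` for an exterior.
      0<rβ : Positive (r * β)
      0<rβ with <-dichotomy r≉0
      ... | inj₁ 0<r = *-cancelˡ-positive 0<r (positive-resp
              (trans (-‿cong A≈-q) (solve 2 (λ r β → :- :- (r :* r :* β) := r :* (r :* β)) refl r β))
              (<0⇒positive (Q<0 (just c) (inj₁ (0<r , centre-inside)))))
      ... | inj₂ r<0 = positive-resp (solve 2 (λ r β → :- r :* :- β := r :* β) refl r β)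
              (*-positive (<0⇒positive r<0) (<0⇒positive (Q<0 ∞ r<0)))

      rβ≈1 : r * β ≈ 1#
      rβ≈1 = positive-square≈1 0<rβ rβ-square

      r⁻¹≈β : r ⁻¹ ≈ β
      r⁻¹≈β = inverse-unique rβ≈1

      r⁻¹*r≈1 : r ⁻¹ * r ≈ 1#
      r⁻¹*r≈1 = trans (*-comm _ _) (⁻¹-inverseʳ r≉0)

    -- The point `∞` gives `β` = 0, and the foot `h n` of the plane gives `α` = 2 `h m`. The
    -- component `k` of `u` along the plane turns out to be null, so `u` = `m n`; the norm gives
    -- `m`² = 1 and one sign gives `m` = 1.
    determined-plane : ∀ n h n≈1 →
      (∀ p → surface (plane n h n≈1) p → Q w p ≈ 0#) →
      (∀ p → region (plane n h n≈1) p → Q w p < 0#) →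
      inversiveCoordinates (plane n h n≈1) ≋ w
    determined-plane n h n≈1 Q≈0 Q<0 = λ
      { 0F → sym (trans α≈ (*-congˡ (trans (*-congˡ m≈1) (*-identityʳ h))))
      ; 1F → sym β≈0
      ; (suc (suc i)) → sym (trans (x-y≈0⇒x≈y (∣x∣²≈0⇒x≋0 {k} ∣k∣²≈0 i))
          (trans (*-congʳ m≈1) (*-identityˡ _)))
      }
      where
      m = u · n
      k = u -ᵛ m *ᵛ n

      β≈0 : β ≈ 0#
      β≈0 = Q≈0 ∞ tt

      Q≈ : ∀ x → Q w (just x) ≈ α - 2# * (u · x)
      Q≈ x = +-congʳ (trans (+-congʳ (trans (*-congʳ β≈0) (zeroˡ _))) (+-identityˡ α))

      n·tn≈t : ∀ t → n · (t *ᵛ n) ≈ t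
      n·tn≈t t = trans (·-*ᵛʳ t n n) (trans (*-congˡ n≈1) (*-identityʳ t))

      α≈ : α ≈ 2# * (h * m)
      α≈ = x-y≈0⇒x≈y (begin
        α - 2# * (h * m)          ≈⟨ +-congˡ (-‿cong (*-congˡ (·-*ᵛʳ h u n))) ⟨
        α - 2# * (u · (h *ᵛ n))   ≈⟨ Q≈ (h *ᵛ n) ⟨
        Q w (just (h *ᵛ n))       ≈⟨ Q≈0 (just (h *ᵛ n)) (n·tn≈t h) ⟩
        0#                        ∎)

      ∣u∣²≈1 : ∣ u ∣² ≈ 1#
      ∣u∣²≈1 = begin
        ∣ u ∣²             ≈⟨ solve 2 (λ U α → U := U :- α :* con (+ 0)) refl ∣ u ∣² α ⟩
        ∣ u ∣² - α * 0#    ≈⟨ +-congˡ (-‿cong (*-congˡ β≈0)) ⟨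
        N w                ≈⟨ Nw≈1 ⟩
        1#                 ∎

      k· : ∀ z → k · z ≈ u · z - m * (n · z)
      k· z = trans (·-cong {y = z} (-ᵛ≋+ᵛ u n m) λ _ → refl) (trans (·-linear u n z (- m))
        (+-congˡ (solve 2 (λ m z → :- m :* z := :- (m :* z)) refl m (n · z))))

      k·n≈0 : k · n ≈ 0#
      k·n≈0 = trans (k· n) (x-x≈0 (sym (trans (*-congˡ n≈1) (*-identityʳ m))))

      -- This point lies on the plane because `k` is orthogonal to `n`; since the form already
      -- vanishes at the foot, its vanishing here says that `k · u` is 0.
      x = k +ᵛ h *ᵛ n

      n·x≈h : n · x ≈ h
      n·x≈h = begin
        n · x                ≈⟨ ·-comm n x ⟩
        x · n                ≈⟨ ·-linear k n n h ⟩
        k · n + h * ∣ n ∣²   ≈⟨ +-cong k·n≈0 (trans (*-congˡ n≈1) (*-identityʳ h)) ⟩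
        0# + h               ≈⟨ +-identityˡ h ⟩
        h                    ∎

      k·u≈0 : k · u ≈ 0#
      k·u≈0 = x*y≈0⇒y≈0 2≉0 (begin
        2# * (k · u)
          ≈⟨ solve 3 (λ K h m → con (+ 2) :* K
               := :- (con (+ 2) :* (h :* m) :- con (+ 2) :* (K :+ h :* m))) refl (k · u) h m ⟩
        - (2# * (h * m) - 2# * (k · u + h * m))
          ≈⟨ -‿cong (+-cong (sym α≈) (-‿cong (*-congˡ (sym (trans (·-linearʳ k n u h) (+-congʳ (·-comm u k))))))) ⟩
        - (α - 2# * (u · x))
          ≈⟨ -‿cong (trans (sym (Q≈ x)) (Q≈0 (just x) n·x≈h)) ⟩
        - 0#
          ≈⟨ solve 0 (:- con (+ 0) := con (+ 0)) refl ⟩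
        0# ∎)

      ∣k∣²≈0 : ∣ k ∣² ≈ 0#
      ∣k∣²≈0 = begin
        ∣ k ∣²                   ≈⟨ k· k ⟩
        u · k - m * (n · k)      ≈⟨ +-cong (trans (·-comm u k) k·u≈0)
                                      (-‿cong (*-congˡ (trans (·-comm n k) k·n≈0))) ⟩
        0# - m * 0#              ≈⟨ solve 1 (λ m → con (+ 0) :- m :* con (+ 0) := con (+ 0)) refl m ⟩
        0#                       ∎

      mm≈1 : m * m ≈ 1#
      mm≈1 = begin
        m * m             ≈⟨ *-congˡ (·-comm u n) ⟩
        m * (n · u)       ≈⟨ x-y≈0⇒x≈y (trans (sym (k· u)) k·u≈0) ⟨
        ∣ u ∣²            ≈⟨ ∣u∣²≈1 ⟩
        1#                ∎

      0<m : Positive m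
      0<m = *-cancelˡ-positive 0<2 (positive-resp (begin
        - Q w (just y)
          ≈⟨ -‿cong (trans (Q≈ y) (+-cong α≈ (-‿cong (*-congˡ (·-*ᵛʳ (h + 1#) u n))))) ⟩
        - (2# * (h * m) - 2# * ((h + 1#) * m))
          ≈⟨ solve 2 (λ h m → :- (con (+ 2) :* (h :* m) :- con (+ 2) :* ((h :+ con (+ 1)) :* m))
               := con (+ 2) :* m) refl h m ⟩
        2# * m ∎) (<0⇒positive (Q<0 (just y) (positive⇒< (positive-resp (begin
          1#                        ≈⟨ solve 1 (λ h → con (+ 1) := (h :+ con (+ 1)) :- h) refl h ⟩
          (h + 1#) - h              ≈⟨ +-congʳ (n·tn≈t (h + 1#)) ⟨
          n · y - h                 ∎) 0<1)))))
        -- A point of the region at distance 1 from the plane.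
        where y = (h + 1#) *ᵛ n

      m≈1 : m ≈ 1#
      m≈1 = positive-square≈1 0<m mm≈1

    determined : ∀ S →
      (∀ p → surface S p → Q w p ≈ 0#) → (∀ p → region S p → Q w p < 0#) →
      inversiveCoordinates S ≋ w
    determined (sphere c r r≉0) = determined-sphere c r r≉0
    determined (plane n h n≈1)  = determined-plane n h n≈1

  -- Inversions as Lorentz reflections

  -- Any multiple of the coordinate vector would do; this one avoids dividing
  -- by the radius.

  mirror : OrientedSphere → Vector Carrier 5
  mirror (sphere c r _) = (∣ c ∣² - r * r) ∷ 1# ∷ c
  mirror (plane n h _)  = 2# * h ∷ 0# ∷ n

  -- The reciprocal of `N (mirror S)`.
  scale : OrientedSphere → Carrier
  scale (sphere c r _) = (r * r) ⁻¹
  scale (plane n h _)  = 1#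

  -- The usual factor 2 of a reflection is already contained in `B`, which is twice the Lorentz
  -- product.
  reflect : OrientedSphere → Vector Carrier 5 → Vector Carrier 5
  reflect S v = v -ᵛ (scale S * B v (mirror S)) *ᵛ mirror S

  ·-+ᵛ : (x y z : ℝ³) → (x +ᵛ y) · z ≈ x · z + y · z
  ·-+ᵛ x y z = solve 9 (λ x₀ x₁ x₂ y₀ y₁ y₂ z₀ z₁ z₂ →
    let x = x₀ ∷ x₁ ∷ x₂ ∷ [] ; y = y₀ ∷ y₁ ∷ y₂ ∷ [] ; z = z₀ ∷ z₁ ∷ z₂ ∷ []
    in (λ i → x i :+ y i) ⊙ z := x ⊙ z :+ y ⊙ z) refl
    (x 0F) (x 1F) (x 2F) (y 0F) (y 1F) (y 2F) (z 0F) (z 1F) (z 2F)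

  reflect-cong : ∀ S {v w} → v ≋ w → reflect S v ≋ reflect S w
  reflect-cong S v≋w i = +-cong (v≋w i)
    (-‿cong (*-congʳ (*-congˡ (B-cong {w = mirror S} v≋w λ _ → refl))))

  reflect-+ᵛ : ∀ S v w → reflect S (v +ᵛ w) ≋ reflect S v +ᵛ reflect S w
  reflect-+ᵛ S v w i = trans
    (+-congˡ (-‿cong (*-congʳ (*-congˡ (+-congʳ (*-congˡ (·-+ᵛ (spatial v) (spatial w) (spatial m))))))))
    (solve 12 (λ x y k z X Y a b a′ b′ c d →
      (x :+ y) :- (k :* (con (+ 2) :* (X :+ Y) :- ((a :+ a′) :* d :+ (b :+ b′) :* c))) :* z
      := (x :- (k :* (con (+ 2) :* X :- (a :* d :+ b :* c))) :* z)
      :+ (y :- (k :* (con (+ 2) :* Y :- (a′ :* d :+ b′ :* c))) :* z)) refl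
      (v i) (w i) (scale S) (m i) (spatial v · spatial m) (spatial w · spatial m)
      (v 0F) (v 1F) (w 0F) (w 1F) (m 0F) (m 1F))
    where m = mirror S

  scale*N≈1 : ∀ S → scale S * N (mirror S) ≈ 1#
  scale*N≈1 (sphere c r r≉0) = trans
    (solve 3 (λ k C R → k :* (C :- (C :- R) :* con (+ 1)) := R :* k) refl ((r * r) ⁻¹) ∣ c ∣² (r * r))
    (⁻¹-inverseʳ (positive⇒≉0 (square-positive r≉0)))
  scale*N≈1 (plane n h n≈1) = trans
    (solve 2 (λ P h → con (+ 1) :* (P :- con (+ 2) :* h :* con (+ 0)) := P) refl ∣ n ∣² h) n≈1

  -- With `k` the scale and `s` the value of `B`, expansion leaves the defect `k s`² (`k` N(m) - 1),
  -- which vanishes by the choice of scale.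
  N-reflect : ∀ S v → N (reflect S v) ≈ N v
  N-reflect S v = begin
    ∣ x -ᵛ t *ᵛ y ∣² - (a - t * a′) * (b - t * b′)
      ≈⟨ +-congʳ (trans (·-cong (-ᵛ≋+ᵛ x y t) (-ᵛ≋+ᵛ x y t)) (∣∣²-line x y (- t))) ⟩
    (∣ x ∣² + 2# * - t * (x · y) + - t * - t * ∣ y ∣²) - (a - t * a′) * (b - t * b′)
      ≈⟨ solve 8 (λ X Z Y a b a′ b′ k →
           let s = con (+ 2) :* Z :- (a :* b′ :+ b :* a′) ; t = k :* s in
           (X :+ con (+ 2) :* :- t :* Z :+ :- t :* :- t :* Y) :- (a :- t :* a′) :* (b :- t :* b′)
           := X :- a :* b :+ k :* (s :* s) :* (k :* (Y :- a′ :* b′) :- con (+ 1))) refl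
           ∣ x ∣² (x · y) ∣ y ∣² a b a′ b′ (scale S) ⟩
    N v + scale S * (s * s) * (scale S * N m - 1#)
      ≈⟨ absorb (x-x≈0 (scale*N≈1 S)) ⟩
    N v ∎
    where
    m = mirror S
    x = spatial v
    y = spatial m
    a = v 0F
    b = v 1F
    a′ = m 0F
    b′ = m 1F
    s = B v m
    t = scale S * s

  module _ (c : ℝ³) (r : Carrier) (r≉0 : ¬ r ≈ 0#) (v : Vector Carrier 5) where
    private
      S = sphere c r r≉0
      a = v 0F
      b = v 1F
      A = Q v (just c)
      R = r * r
      k = R ⁻¹
      m = mirror S

      0<R : Positive R
      0<R = square-positive r≉0

      Rk≈1 : R * k ≈ 1#
      Rk≈1 = ⁻¹-inverseʳ (positive⇒≉0 0<R)

      B≈ : B v m ≈ b * R - A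
      B≈ = solve 5 (λ a b C R X →
        con (+ 2) :* X :- (a :* con (+ 1) :+ b :* (C :- R))
        := b :* R :- (b :* C :+ a :- con (+ 2) :* X)) refl a b ∣ c ∣² R (spatial v · c)

      Q-mirror-centre : Q m (just c) ≈ - R
      Q-mirror-centre = solve 2 (λ C R → con (+ 1) :* C :+ (C :- R) :- con (+ 2) :* C := :- R) refl ∣ c ∣² R

      Q-reflect≈ : ∀ p → Q (reflect S v) p ≈ Q v p - k * (b * R - A) * Q m p
      Q-reflect≈ p = trans (Q-sub v m _ p) (+-congˡ (-‿cong (*-congʳ (*-congˡ B≈))))

    -- With `R` = `r * r`, the positive factor is `R` at `∞`, 1/`R` at the centre, and `R` / |x -
    -- c|² elsewhere.
    Q-reflect-sphere : ∀ p → Q (reflect S v) (inversion S p) ∼ Q v p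
    Q-reflect-sphere ∞ = R , 0<R , (begin
      Q (reflect S v) (just c)              ≈⟨ Q-reflect≈ (just c) ⟩
      A - k * (b * R - A) * Q m (just c)    ≈⟨ +-congˡ (-‿cong (*-congˡ Q-mirror-centre)) ⟩
      A - k * (b * R - A) * - R             ≈⟨ solve 4 (λ A k b R → A :- k :* (b :* R :- A) :* :- R
                                                 := R :* b :+ (b :* R :- A) :* (R :* k :- con (+ 1)))
                                                 refl A k b R ⟩
      R * b + (b * R - A) * (R * k - 1#)    ≈⟨ absorb (x-x≈0 Rk≈1) ⟩
      R * b                                 ∎)
    Q-reflect-sphere (just x) with x ≟ᵛ c
    ... | yes x≋c = k , inverse-positive 0<R Rk≈1 , (begin
      Q (reflect S v) ∞                     ≈⟨ Q-reflect≈ ∞ ⟩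
      b - k * (b * R - A) * 1#              ≈⟨ solve 4 (λ A k b R → b :- k :* (b :* R :- A) :* con (+ 1)
                                                 := k :* A :+ :- b :* (R :* k :- con (+ 1))) refl A k b R ⟩
      k * A + - b * (R * k - 1#)            ≈⟨ absorb (x-x≈0 Rk≈1) ⟩
      k * A                                 ≈⟨ *-congˡ (Q-congʳ v (just x≋c)) ⟨
      k * Q v (just x)                      ∎)
    ... | no x≉c = t , *-positive 0<R (inverse-positive 0<∣d∣² ∣d∣²-inverse) , (begin
      Q (reflect S v) (just y)
        ≈⟨ Q-reflect≈ (just y) ⟩
      Q v (just y) - k * (b * R - A) * Q m (just y)
        ≈⟨ +-cong (Q-line v c d t) (-‿cong (*-congˡ
             (trans (Q-line m c d t) (+-congʳ (+-congʳ Q-mirror-centre))))) ⟩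
      (A + t * E + t * t * (b * ∣ d ∣²))
        - k * (b * R - A) * (- R + t * (2# * (1# * (c · d) - c · d)) + t * t * (1# * ∣ d ∣²))
        -- The first summand keeps its explicit ones to agree with `Q-line` at parameter 1, where
        -- the line passes through `x`. The other two are multiples of `t D - R` and `R k - 1`, both
        -- zero.
        ≈⟨ solve 8 (λ A t E b k R D P →
             (A :+ t :* E :+ t :* t :* (b :* D)) :- k :* (b :* R :- A) :*
               (:- R :+ t :* (con (+ 2) :* (con (+ 1) :* P :- P)) :+ t :* t :* (con (+ 1) :* D))
             := t :* (A :+ con (+ 1) :* E :+ con (+ 1) :* con (+ 1) :* (b :* D))
               :+ (b :* t :- k :* (b :* R :- A) :* t :- b) :* (t :* D :- R)
               :+ (:- ((b :* R :- A) :* (t :- con (+ 1)))) :* (R :* k :- con (+ 1))) refl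
             A t E b k R ∣ d ∣² (c · d) ⟩
      t * (A + 1# * E + 1# * 1# * (b * ∣ d ∣²))
        + (b * t - k * (b * R - A) * t - b) * (t * ∣ d ∣² - R)
        + (- ((b * R - A) * (t - 1#))) * (R * k - 1#)
        ≈⟨ trans (absorb (x-x≈0 Rk≈1)) (absorb (x-x≈0 t∣d∣²≈R)) ⟩
      t * (A + 1# * E + 1# * 1# * (b * ∣ d ∣²))
        ≈⟨ *-congˡ (Q-line v c d 1#) ⟨
      t * Q v (just (c +ᵛ 1# *ᵛ d))
        ≈⟨ *-congˡ (Q-congʳ v (just λ i →
             solve 2 (λ c x → c :+ con (+ 1) :* (x :- c) := x) refl (c i) (x i))) ⟩
      t * Q v (just x) ∎)
      where
      d = x -ᵛ c
      t = R * ∣ d ∣² ⁻¹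
      y = c +ᵛ t *ᵛ d
      E = 2# * (b * (c · d) - spatial v · d)

      0<∣d∣² : Positive ∣ d ∣²
      0<∣d∣² = 0≤∣∣² d , λ p → x≉c λ i → x-y≈0⇒x≈y (∣x∣²≈0⇒x≋0 {d} (sym p) i)

      ∣d∣²-inverse : ∣ d ∣² * ∣ d ∣² ⁻¹ ≈ 1#
      ∣d∣²-inverse = ⁻¹-inverseʳ (positive⇒≉0 0<∣d∣²)

      t∣d∣²≈R : t * ∣ d ∣² ≈ R
      t∣d∣²≈R = trans (*-assoc R _ _) (trans (*-congˡ (trans (*-comm _ _) ∣d∣²-inverse)) (*-identityʳ R))

  -- Reflection in a plane is a Euclidean isometry, so the factor is 1 and equality holds exactly.
  Q-reflect-plane : ∀ n h n≈1 v p →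
    Q (reflect (plane n h n≈1) v) (inversion (plane n h n≈1) p) ≈ Q v p
  Q-reflect-plane n h n≈1 v ∞ =
    solve 2 (λ b s → b :- s :* con (+ 0) := b) refl (v 1F) (1# * B v (mirror (plane n h n≈1)))
  Q-reflect-plane n h n≈1 v (just x) = begin
    Q (reflect S v) (just y)
      ≈⟨ Q-sub v m _ (just y) ⟩
    Q v (just y) - 1# * B v m * Q m (just y)
      ≈⟨ +-cong (Q-y v) (-‿cong (*-congˡ (Q-y m))) ⟩
    (V + - t * (2# * (b * (x · n) - spatial v · n)) + - t * - t * (b * ∣ n ∣²))
      - 1# * B v m * (Q m (just x) + - t * (2# * (0# * (x · n) - ∣ n ∣²)) + - t * - t * (0# * ∣ n ∣²))
      ≈⟨ +-cong (+-congʳ (+-congˡ (*-congˡ (*-congˡ (+-congʳ (*-congˡ (·-comm x n)))))))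
           (-‿cong (*-congˡ (+-congʳ (+-congˡ (*-congˡ (*-congˡ (+-congʳ (*-congˡ (·-comm x n))))))))) ⟩
    (V + - t * (2# * (b * (n · x) - spatial v · n)) + - t * - t * (b * ∣ n ∣²))
      - 1# * B v m * (Q m (just x) + - t * (2# * (0# * (n · x) - ∣ n ∣²)) + - t * - t * (0# * ∣ n ∣²))
      ≈⟨ solve 8 (λ V a b h P W M X →
           let t = con (+ 2) :* (P :- h)
               s = con (+ 2) :* W :- (a :* con (+ 0) :+ b :* (con (+ 2) :* h)) in
           (V :+ :- t :* (con (+ 2) :* (b :* P :- W)) :+ :- t :* :- t :* (b :* M))
             :- con (+ 1) :* s :* ((con (+ 0) :* X :+ con (+ 2) :* h :- con (+ 2) :* P)
               :+ :- t :* (con (+ 2) :* (con (+ 0) :* P :- M)) :+ :- t :* :- t :* (con (+ 0) :* M))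
           := V :+ (t :* t :* b :- con (+ 2) :* s :* t) :* (M :- con (+ 1))) refl
           V (v 0F) b h (n · x) (spatial v · n) ∣ n ∣² ∣ x ∣² ⟩
    V + (t * t * b - 2# * B v m * t) * (∣ n ∣² - 1#)
      ≈⟨ absorb (x-x≈0 n≈1) ⟩
    V ∎
    where
    S = plane n h n≈1
    m = mirror S
    t = 2# * (n · x - h)
    y = x -ᵛ t *ᵛ n
    V = Q v (just x)
    b = v 1F

    Q-y : ∀ v → Q v (just y) ≈
      Q v (just x) + - t * (2# * (v 1F * (x · n) - spatial v · n)) + - t * - t * (v 1F * ∣ n ∣²)
    Q-y v = trans (Q-congʳ v (just (-ᵛ≋+ᵛ x n t))) (Q-line v x n (- t))

  Q-reflect : ∀ S v p → Q (reflect S v) (inversion S p) ∼ Q v p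
  Q-reflect (sphere c r r≉0) v p = Q-reflect-sphere c r r≉0 v p
  Q-reflect (plane n h n≈1)  v p = ∼-reflexive (Q-reflect-plane n h n≈1 v p)

  -- Möbius transformations as linear maps on coordinate vectors

  reflections : List OrientedSphere → Vector Carrier 5 → Vector Carrier 5
  reflections Ss v = foldr reflect v Ss

  reflections-cong : ∀ Ss {v w} → v ≋ w → reflections Ss v ≋ reflections Ss w
  reflections-cong List.[]       v≋w = v≋w
  reflections-cong (S List.∷ Ss) v≋w = reflect-cong S (reflections-cong Ss v≋w)

  reflections-+ᵛ : ∀ Ss v w → reflections Ss (v +ᵛ w) ≋ reflections Ss v +ᵛ reflections Ss w
  reflections-+ᵛ List.[]       v w i = refl
  reflections-+ᵛ (S List.∷ Ss) v w i =
    trans (reflect-cong S (reflections-+ᵛ Ss v w) i) (reflect-+ᵛ S (reflections Ss v) (reflections Ss w) i)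

  N-reflections : ∀ Ss v → N (reflections Ss v) ≈ N v
  N-reflections List.[]       v = refl
  N-reflections (S List.∷ Ss) v = trans (N-reflect S (reflections Ss v)) (N-reflections Ss v)

  Q-reflections : ∀ Ss v p → Q (reflections Ss v) (foldr inversion p Ss) ∼ Q v p
  Q-reflections List.[]       v p = ∼-reflexive refl
  Q-reflections (S List.∷ Ss) v p =
    ∼-trans (Q-reflect S (reflections Ss v) (foldr inversion p Ss)) (Q-reflections Ss v p)

  module _ {f : ℝ̂³ → ℝ̂³} (isMöbius : IsMöbius f) where
    private
      Ss = proj₁ isMöbius
      f≈ = proj₂ isMöbius

    Q-image : ∀ v {p q} → f p ≈̂ q → Q (reflections Ss v) q ∼ Q v p
    Q-image v {p} {q} fp≈q = ∼-trans
      (∼-reflexive (trans (sym (Q-congʳ (reflections Ss v) fp≈q)) (Q-congʳ (reflections Ss v) (f≈ p))))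
      (Q-reflections Ss v p)

    -- Every point of the surface or region of `T` has a preimage in that of `S`, so the reflected
    -- vector has the zeros and signs required by `determined`; its norm is still 1.
    maps⇒reflections : ∀ S T → f Maps S To T →
      inversiveCoordinates T ≋ reflections Ss (inversiveCoordinates S)
    maps⇒reflections S T ((_ , surface⊆) , (_ , region⊆)) =
      determined {reflections Ss v} (trans (N-reflections Ss v) (N-inversiveCoordinates S)) T
        (λ q q∈T → let p , p∈S , fp≈q = surface⊆ {q} q∈T in ∼-≈0 (Q-image v fp≈q) (surface⇒Q≈0 S p∈S))
        (λ q q∈T → let p , p∈S , fp≈q = region⊆ {q} q∈T in ∼-<0 (Q-image v fp≈q) (region⇒Q<0 S p∈S))
      where v = inversiveCoordinates S

  -- Common points of spheres with Lorentz product -1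

  -- The common point is where the light-like vector v + w lies over ℝ³.

  tangency-point : ∀ {v w} i z → N v ≈ 1# → N w ≈ 1# → B v w ≈ - 2# →
    i * (v 1F + w 1F) ≈ 1# → z ≋ spatial v +ᵛ spatial w → Q v (just (i *ᵛ z)) ≈ 0#
  tangency-point {v} {w} i z Nv≈1 Nw≈1 B≈-2 i≈ z≋ = begin
    b * ∣ i *ᵛ z ∣² + a - 2# * (x · (i *ᵛ z))
      ≈⟨ +-cong (+-congʳ (*-congˡ (trans (scale· (i *ᵛ z)) (*-congˡ (trans (·-comm z (i *ᵛ z)) (scale· z))))))
           (-‿cong (*-congˡ (trans (·-comm x (i *ᵛ z)) (scale· x)))) ⟩
    b * (i * (i * (z · z))) + a - 2# * (i * (z · x))
      ≈⟨ +-cong (+-congʳ (*-congˡ (*-congˡ (*-congˡ (trans (z· z) (+-cong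
           (trans (·-comm x z) z·x≈) (trans (·-comm y z) (z· y))))))))
           (-‿cong (*-congˡ (*-congˡ z·x≈))) ⟩
    b * (i * (i * ((∣ x ∣² + x · y) + (x · y + ∣ y ∣²)))) + a - 2# * (i * (∣ x ∣² + x · y))
      -- The form at the point is a polynomial combination of the four hypotheses: the two norms,
      -- the Lorentz product, and the equation making `i` the inverse of the total bend.
      ≈⟨ solve 8 (λ b a b′ a′ i X Y Z →
           b :* (i :* (i :* ((X :+ Z) :+ (Z :+ Y)))) :+ a :- con (+ 2) :* (i :* (X :+ Z))
           := con (+ 0)
             :+ (b :* i :* i :- con (+ 2) :* i) :* ((X :- a :* b) :- con (+ 1))
             :+ (b :* i :* i) :* ((Y :- a′ :* b′) :- con (+ 1))
             :+ (b :* i :* i :- i) :* ((con (+ 2) :* Z :- (a :* b′ :+ b :* a′)) :- (:- con (+ 2)))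
             :+ (b :* i :* (a :+ a′) :- a) :* (i :* (b :+ b′) :- con (+ 1))) refl
           b a (w 1F) (w 0F) i ∣ x ∣² ∣ y ∣² (x · y) ⟩
    0# + (b * i * i - 2# * i) * (N v - 1#) + (b * i * i) * (N w - 1#)
      + (b * i * i - i) * (B v w - - 2#)
      + (b * i * (a + w 0F) - a) * (i * (b + w 1F) - 1#)
      ≈⟨ trans (absorb (x-x≈0 i≈)) (trans (absorb (x-x≈0 B≈-2))
           (trans (absorb (x-x≈0 Nw≈1)) (absorb (x-x≈0 Nv≈1)))) ⟩
    0# ∎
    where
    a = v 0F
    b = v 1F
    x = spatial v
    y = spatial w
    scale· : ∀ u → (i *ᵛ z) · u ≈ i * (z · u)
    scale· u = ·-*ᵛ i z u
    z· : ∀ u → z · u ≈ x · u + y · u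
    z· u = trans (·-cong {y = u} z≋ λ _ → refl) (·-+ᵛ x y u)
    z·x≈ : z · x ≈ ∣ x ∣² + x · y
    z·x≈ = trans (z· x) (+-congˡ (·-comm y x))

  -- N(v + w) = N(v) + N(w) + B(v, w) = 0, so the sum is light-like. If its bend is 0, nonnegativity
  -- makes both bends 0 and the common point is `∞`; otherwise dividing by the bend gives a finite
  -- point.
  common-point : ∀ {v w} → N v ≈ 1# → N w ≈ 1# → B v w ≈ - 2# → 0# ≤ v 1F → 0# ≤ w 1F →
    ∃[ p ] Q v p ≈ 0# × Q w p ≈ 0#
  common-point {v} {w} Nv≈1 Nw≈1 B≈-2 0≤v 0≤w with v 1F + w 1F ≟ 0#
  ... | yes q = ∞ , x+y≈0⇒x≈0 0≤v 0≤w q , x+y≈0⇒y≈0 0≤v 0≤w q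
  ... | no ≉0 = just (i *ᵛ z) ,
      tangency-point {v} {w} i z Nv≈1 Nw≈1 B≈-2 i≈ (λ _ → refl) ,
      tangency-point {w} {v} i z Nw≈1 Nv≈1 (trans B-comm B≈-2) (trans (*-congˡ (+-comm _ _)) i≈)
        (λ _ → +-comm _ _)
    where
    i = (v 1F + w 1F) ⁻¹
    z = spatial v +ᵛ spatial w
    i≈ : i * (v 1F + w 1F) ≈ 1#
    i≈ = trans (*-comm _ _) (⁻¹-inverseʳ ≉0)
    B-comm : B w v ≈ B v w
    B-comm = +-cong (*-congˡ (·-comm (spatial w) (spatial v)))
      (-‿cong (trans (+-comm _ _) (+-cong (*-comm _ _) (*-comm _ _))))

  -- Classification of the pairs in the standard configuration

  private
    -- The coordinates of 𝒱₀ with an indeterminate in place of √2, which makes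
    -- identities between them decidable.

    𝒱̂ : Fin 8 → Vector (Polynomial 1) 5
    𝒱̂ = (con (+ 2) ∷ con (+ 0) ∷ con (+ 0)  ∷ con (+ 0)  ∷ con (+ 1)    ∷ [])
      ∷ (con (+ 2) ∷ con (+ 0) ∷ con (+ 0)  ∷ con (+ 0)  ∷ con -[1+ 0 ] ∷ [])
      ∷ (con (+ 1) ∷ con (+ 1) ∷ var 0F     ∷ con (+ 0)  ∷ con (+ 0)    ∷ [])
      ∷ (con (+ 1) ∷ con (+ 1) ∷ con (+ 0)  ∷ var 0F     ∷ con (+ 0)    ∷ [])
      ∷ (con (+ 0) ∷ con (+ 2) ∷ con (+ 0)  ∷ con (+ 0)  ∷ con -[1+ 0 ] ∷ [])
      ∷ (con (+ 0) ∷ con (+ 2) ∷ con (+ 0)  ∷ con (+ 0)  ∷ con (+ 1)    ∷ [])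
      ∷ (con (+ 1) ∷ con (+ 1) ∷ :- var 0F  ∷ con (+ 0)  ∷ con (+ 0)    ∷ [])
      ∷ (con (+ 1) ∷ con (+ 1) ∷ con (+ 0)  ∷ :- var 0F  ∷ con (+ 0)    ∷ [])
      ∷ []

    ⟦𝒱̂⟧ : Matrix 8 5
    ⟦𝒱̂⟧ j i = ⟦ 𝒱̂ j i ⟧ (√2 Vec.∷ Vec.[])

    B̂ : Fin 8 → Fin 8 → Polynomial 1
    B̂ j k = con (+ 2) :* ((λ i → x (suc (suc i))) ⊙ (λ i → y (suc (suc i))))
      :- (x 0F :* y 1F :+ x 1F :* y 0F)
      where
      x = 𝒱̂ j
      y = 𝒱̂ k

    ≋-intro : {x y : Vector Carrier 5} → x 0F ≈ y 0F → x 1F ≈ y 1F → x 2F ≈ y 2F → x 3F ≈ y 3F →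
      x 4F ≈ y 4F → x ≋ y
    ≋-intro p q r s t = λ { 0F → p ; 1F → q ; 2F → r ; 3F → s ; 4F → t }

    ⟦𝒱̂⟧≋ : ∀ j → 𝒱₀-inversiveCoordinates j ≋ ⟦𝒱̂⟧ j
    ⟦𝒱̂⟧≋ 0F = ≋-intro refl refl refl refl refl
    ⟦𝒱̂⟧≋ 1F = ≋-intro refl refl refl refl refl
    ⟦𝒱̂⟧≋ 2F = ≋-intro refl refl refl refl refl
    ⟦𝒱̂⟧≋ 3F = ≋-intro refl refl refl refl refl
    ⟦𝒱̂⟧≋ 4F = ≋-intro refl refl refl refl refl
    ⟦𝒱̂⟧≋ 5F = ≋-intro refl refl refl refl refl
    ⟦𝒱̂⟧≋ 6F = ≋-intro refl refl refl refl refl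
    ⟦𝒱̂⟧≋ 7F = ≋-intro refl refl refl refl refl

    -- Normal forms have integer coefficients, so this Boolean computes although the field is
    -- abstract.
    _≐?_ : ∀ {n} → Polynomial n → Polynomial n → Bool
    p ≐? q = is-just (normalise p ≟N normalise q)

    ≐?-sound : ∀ {n} (p q : Polynomial n) ρ → T (p ≐? q) → ⟦ p ⟧ ρ ≈ ⟦ q ⟧ ρ
    ≐?-sound p q ρ t = prove ρ p q (⟦ to-witness-T (normalise p ≟N normalise q) t ⟧N-cong ρ)

    Antipodal Tangential : Rel (Fin 8) 0ℓ
    Antipodal j k  = ∀ i → T ((𝒱̂ j i :+ 𝒱̂ k i) ≐? (𝒱̂ 0F i :+ 𝒱̂ 4F i))
    -- The constant is -2, that is, Lorentz product -1.
    Tangential j k = T (B̂ j k ≐? con -[1+ 1 ])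

    classify? : ∀ j k → Dec (j ≡ k ⊎ Antipodal j k ⊎ Tangential j k)
    classify? j k = (j Fin.≟ k) ⊎-dec (Fin.all? (λ i → T? _) ⊎-dec T? _)

    -- All 64 pairs are settled by evaluating the decision procedure during type checking.
    classify : ∀ j k → j ≡ k ⊎ Antipodal j k ⊎ Tangential j k
    classify = toWitness {a? = Fin.all? λ j → Fin.all? (classify? j)} tt

  v₀ : Matrix 8 5
  v₀ j = inversiveCoordinates (𝒱₀ j)

  v₀≋ : ∀ j → v₀ j ≋ ⟦𝒱̂⟧ j
  v₀≋ j i = trans (inversiveCoordinates-𝒱₀ j i) (⟦𝒱̂⟧≋ j i)

  𝒱₀-bend-nonneg : ∀ j → 0# ≤ v₀ j 1F
  𝒱₀-bend-nonneg j = ≤-respʳ-≈ (sym (inversiveCoordinates-𝒱₀ j 1F)) (nonneg j)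
    where
    nonneg : ∀ j → 0# ≤ 𝒱₀-inversiveCoordinates j 1F
    nonneg 0F = ≤-refl
    nonneg 1F = ≤-refl
    nonneg 2F = 0≤1
    nonneg 3F = 0≤1
    nonneg 4F = 0≤2
    nonneg 5F = 0≤2
    nonneg 6F = 0≤1
    nonneg 7F = 0≤1

  private
    antipodal⇒sum : ∀ j k → Antipodal j k → v₀ j +ᵛ v₀ k ≋ v₀ 0F +ᵛ v₀ 4F
    antipodal⇒sum j k antipodal i = begin
      v₀ j i + v₀ k i          ≈⟨ +-cong (v₀≋ j i) (v₀≋ k i) ⟩
      ⟦𝒱̂⟧ j i + ⟦𝒱̂⟧ k i        ≈⟨ ≐?-sound (𝒱̂ j i :+ 𝒱̂ k i) (𝒱̂ 0F i :+ 𝒱̂ 4F i) _ (antipodal i) ⟩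
      ⟦𝒱̂⟧ 0F i + ⟦𝒱̂⟧ 4F i      ≈⟨ +-cong (v₀≋ 0F i) (v₀≋ 4F i) ⟨
      v₀ 0F i + v₀ 4F i        ∎

    tangential⇒common-point : ∀ j k → Tangential j k → ∃[ p ] surface (𝒱₀ j) p × surface (𝒱₀ k) p
    tangential⇒common-point j k tangential =
      let p , p∈j , p∈k = common-point {v₀ j} {v₀ k}
            (N-inversiveCoordinates (𝒱₀ j)) (N-inversiveCoordinates (𝒱₀ k)) B≈-2
            (𝒱₀-bend-nonneg j) (𝒱₀-bend-nonneg k)
      in p , Q≈0⇒surface (𝒱₀ j) p∈j , Q≈0⇒surface (𝒱₀ k) p∈k
      where
      B≈-2 : B (v₀ j) (v₀ k) ≈ - 2#
      B≈-2 = trans (B-cong {v₀ j} {⟦𝒱̂⟧ j} {v₀ k} {⟦𝒱̂⟧ k} (v₀≋ j) (v₀≋ k))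
        (≐?-sound (B̂ j k) (con -[1+ 1 ]) (√2 Vec.∷ Vec.[]) tangential)

    classified⇒antipodal : ∀ j k → j ≡ k ⊎ Antipodal j k ⊎ Tangential j k →
      j ≢ k → Disjoint (𝒱₀ j) (𝒱₀ k) → Antipodal j k
    classified⇒antipodal j k (inj₁ j≡k)               j≢k disjoint = contradiction j≡k j≢k
    classified⇒antipodal j k (inj₂ (inj₁ antipodal))  j≢k disjoint = antipodal
    classified⇒antipodal j k (inj₂ (inj₂ tangential)) j≢k disjoint =
      let p , p∈ = tangential⇒common-point j k tangential in contradiction p∈ (disjoint p)

  𝒱₀-disjoint⇒antipodal : ∀ j k → j ≢ k → Disjoint (𝒱₀ j) (𝒱₀ k) →
    v₀ j +ᵛ v₀ k ≋ v₀ 0F +ᵛ v₀ 4F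
  𝒱₀-disjoint⇒antipodal j k j≢k disjoint =
    antipodal⇒sum j k (classified⇒antipodal j k (classify j k) j≢k disjoint)

  -- A common point of `S` and `S′` would be carried by `f` to one of `T` and `T′`. This transports
  -- disjointness back to the standard configuration.
  maps-disjoint : ∀ f {S S′ T T′} → f Maps S To T → f Maps S′ To T′ → Disjoint T T′ → Disjoint S S′
  maps-disjoint f {S} {S′} {T} {T′} ((⊆T , _) , _) ((⊆T′ , _) , _) disjoint p (p∈S , p∈S′) =
    disjoint (f p) (⊆T {f p} (p , p∈S , ≈̂-refl) , ⊆T′ {f p} (p , p∈S′ , ≈̂-refl))
    where
    ≈̂-refl : ∀ {p} → p ≈̂ p
    ≈̂-refl {∞}      = nothing
    ≈̂-refl {just x} = just λ _ → refl

  -- The matrix factorisation from the midpoint equations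

  reflected-through-midpoint : ∀ {m x y} → m ≈ ½ * (x + y) → y ≈ - x + 2# * m
  reflected-through-midpoint {m} {x} {y} e = sym (begin
    - x + 2# * m              ≈⟨ +-congˡ (*-congˡ e) ⟩
    - x + 2# * (½ * (x + y))  ≈⟨ +-congˡ (trans (sym (*-assoc 2# ½ _)) (trans (*-congʳ 2*½≈1) (*-identityˡ _))) ⟩
    - x + (x + y)             ≈⟨ solve 2 (λ x y → :- x :+ (x :+ y) := y) refl x y ⟩
    y                         ∎)

  private
    row : ∀ {n} → Vector (Polynomial n) 5 → Vector (Polynomial n) 5 → Polynomial n
    row d x = d 0F :* x 0F :+ (d 1F :* x 1F :+ (d 2F :* x 2F :+ (d 3F :* x 3F :+ (d 4F :* x 4F :+ con (+ 0)))))

    0̂ 1̂ 2̂ : ∀ {n} → Polynomial n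
    0̂ = con (+ 0)
    1̂ = con (+ 1)
    2̂ = con (+ 2)

  -- Works on a single column: `x` is a column of the V-matrix and `m` the matching entry of the
  -- antipodal vector. The upper four rows select an entry; the lower four reflect it through `m`.
  V≈D*F : (x : Vector Carrier 8) (m : Carrier) →
    m ≈ ½ * (x 0F + x 4F) → m ≈ ½ * (x 1F + x 5F) →
    m ≈ ½ * (x 2F + x 6F) → m ≈ ½ * (x 3F + x 7F) →
    ∀ i → x i ≈ sum (λ j → D i j * (x 0F ∷ x 1F ∷ x 2F ∷ x 3F ∷ m ∷ []) j)
  V≈D*F x m p q r s = λ
    { 0F → solve 5 (λ a b c d m →
        a := row (1̂ ∷ 0̂ ∷ 0̂ ∷ 0̂ ∷ 0̂ ∷ []) (a ∷ b ∷ c ∷ d ∷ m ∷ [])) refl x₀ x₁ x₂ x₃ m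
    ; 1F → solve 5 (λ a b c d m →
        b := row (0̂ ∷ 1̂ ∷ 0̂ ∷ 0̂ ∷ 0̂ ∷ []) (a ∷ b ∷ c ∷ d ∷ m ∷ [])) refl x₀ x₁ x₂ x₃ m
    ; 2F → solve 5 (λ a b c d m →
        c := row (0̂ ∷ 0̂ ∷ 1̂ ∷ 0̂ ∷ 0̂ ∷ []) (a ∷ b ∷ c ∷ d ∷ m ∷ [])) refl x₀ x₁ x₂ x₃ m
    ; 3F → solve 5 (λ a b c d m →
        d := row (0̂ ∷ 0̂ ∷ 0̂ ∷ 1̂ ∷ 0̂ ∷ []) (a ∷ b ∷ c ∷ d ∷ m ∷ [])) refl x₀ x₁ x₂ x₃ m
    ; 4F → trans (reflected-through-midpoint p) (solve 5 (λ a b c d m →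
        :- a :+ 2̂ :* m := row (:- 1̂ ∷ 0̂ ∷ 0̂ ∷ 0̂ ∷ 2̂ ∷ []) (a ∷ b ∷ c ∷ d ∷ m ∷ [])) refl x₀ x₁ x₂ x₃ m)
    ; 5F → trans (reflected-through-midpoint q) (solve 5 (λ a b c d m →
        :- b :+ 2̂ :* m := row (0̂ ∷ :- 1̂ ∷ 0̂ ∷ 0̂ ∷ 2̂ ∷ []) (a ∷ b ∷ c ∷ d ∷ m ∷ [])) refl x₀ x₁ x₂ x₃ m)
    ; 6F → trans (reflected-through-midpoint r) (solve 5 (λ a b c d m →
        :- c :+ 2̂ :* m := row (0̂ ∷ 0̂ ∷ :- 1̂ ∷ 0̂ ∷ 2̂ ∷ []) (a ∷ b ∷ c ∷ d ∷ m ∷ [])) refl x₀ x₁ x₂ x₃ m)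
    ; 7F → trans (reflected-through-midpoint s) (solve 5 (λ a b c d m →
        :- d :+ 2̂ :* m := row (0̂ ∷ 0̂ ∷ 0̂ ∷ :- 1̂ ∷ 2̂ ∷ []) (a ∷ b ∷ c ∷ d ∷ m ∷ [])) refl x₀ x₁ x₂ x₃ m)
    }
    where
    x₀ = x 0F
    x₁ = x 1F
    x₂ = x 2F
    x₃ = x 3F

  -- Transfer to an arbitrary admissibly ordered configuration

  module _ (𝒱 : Vector OrientedSphere 8) (platonic : OrthoplicialPlatonic 𝒱) (admissible : Admissible 𝒱) where
    private
      f          = proj₁ platonic
      isMöbius   = proj₁ (proj₂ platonic)
      Ss         = proj₁ isMöbius
      π          = proj₁ (proj₂ (proj₂ platonic))
      maps       = proj₂ (proj₂ (proj₂ platonic))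

    v : Matrix 8 5
    v = V-matrix 𝒱

    -- The right-hand side is free of `i` and `j`: by additivity, each such pair has as its sum the
    -- image of the common sum in the standard configuration.
    antipodal-sum : ∀ i j → i ≢ j → toℕ i % 4 ≡ toℕ j % 4 →
      v i +ᵛ v j ≋ reflections Ss (v₀ 0F +ᵛ v₀ 4F)
    antipodal-sum i j i≢j i≡j k = begin
      v i k + v j k
        ≈⟨ +-cong (maps⇒reflections isMöbius _ _ (maps i) k) (maps⇒reflections isMöbius _ _ (maps j) k) ⟩
      reflections Ss (v₀ (π ⟨$⟩ʳ i)) k + reflections Ss (v₀ (π ⟨$⟩ʳ j)) k
        ≈⟨ reflections-+ᵛ Ss _ _ k ⟨
      reflections Ss (v₀ (π ⟨$⟩ʳ i) +ᵛ v₀ (π ⟨$⟩ʳ j)) k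
        ≈⟨ reflections-cong Ss (𝒱₀-disjoint⇒antipodal (π ⟨$⟩ʳ i) (π ⟨$⟩ʳ j)
             -- A permutation is injective, so distinct indices stay distinct in the standard
             -- configuration.
             (λ e → i≢j (Injection.injective (↔⇒↣ π) e))
             (maps-disjoint f (maps i) (maps j) (proj₂ (admissible i j i≢j) i≡j))) k ⟩
      reflections Ss (v₀ 0F +ᵛ v₀ 4F) k ∎

    antipodalVector≋ : ∀ i j → i ≢ j → toℕ i % 4 ≡ toℕ j % 4 →
      antipodalVector 𝒱 ≋ ½ *ᵛ (v i +ᵛ v j)
    antipodalVector≋ i j i≢j i≡j k =
      *-congˡ (trans (antipodal-sum 0F 4F (λ ()) ≡.refl k) (sym (antipodal-sum i j i≢j i≡j k)))

corollary3p5 :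
    (ℝ : CompleteOrderedField) →
    let open Inversive ℝ
        open CompleteOrderedField ℝ using (½) in
    (𝒱 : Vector OrientedSphere 8) → OrthoplicialPlatonic 𝒱 → Admissible 𝒱 →
    let v  = λ k → inversiveCoordinates (𝒱 k)
        vμ = antipodalVector 𝒱 in
    (vμ ≋ ½ *ᵛ (v 0F +ᵛ v 4F) ×
     vμ ≋ ½ *ᵛ (v 1F +ᵛ v 5F) ×
     vμ ≋ ½ *ᵛ (v 2F +ᵛ v 6F) ×
     vμ ≋ ½ *ᵛ (v 3F +ᵛ v 7F)) ×
    V-matrix 𝒱 ≈ᴹ D *ᴹ F-matrix 𝒱
corollary3p5 ℝ 𝒱 platonic admissible =
  (mid₀ , mid₁ , mid₂ , mid₃) ,
  -- For fixed `k`, the five-term sum in the matrix product unfolds to the sum in `V≈D*F` for column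
  -- `k`.
  λ i k → V≈D*F (λ j → V-matrix 𝒱 j k) (antipodalVector 𝒱 k) (mid₀ k) (mid₁ k) (mid₂ k) (mid₃ k) i
  where
  open Inversive ℝ
  open Geometry ℝ
  midpoint = antipodalVector≋ 𝒱 platonic admissible
  mid₀ = midpoint 0F 4F (λ ()) ≡.refl
  mid₁ = midpoint 1F 5F (λ ()) ≡.refl
  mid₂ = midpoint 2F 6F (λ ()) ≡.refl
  mid₃ = midpoint 3F 7F (λ ()) ≡.refl
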